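{- A perfect Euler cuboid exists if and only if there exist integers $a,b,c,u$ with $c>0$, $0<u/c<1$ and $(a/c,\,b/c)\in D_{ab}$ satisfying the homogeneous Diophantine equation of degree $12$ $$\begin{aligned}&u^4a^4b^4+6a^4u^2b^4c^2-2u^4a^4b^2c^2-2u^4a^2b^4c^2+4u^2b^4a^2c^4+4a^4u^2b^2c^4-12u^4a^2b^2c^4\\&+u^4a^4c^4+u^4b^4c^4+a^4b^4c^4+6a^4u^2c^6+6u^2b^4c^6-8a^2b^2u^2c^6-2u^4a^2c^6-2u^4b^2c^6\\&-2a^4b^2c^6-2b^4a^2c^6+u^4c^8+b^4c^8+a^4c^8+4a^2u^2c^8+4b^2u^2c^8-12b^2a^2c^8\\&+6u^2c^{10}-2a^2c^{10}-2b^2c^{10}+c^{12}=0.\end{aligned}$$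
   Context: An Euler cuboid is a rectangular parallelepiped whose three edge lengths and three face diagonal lengths are all positive integers; a perfect Euler cuboid is an Euler cuboid whose space diagonal also has integer length, i.e. a $7$-tuple of positive integers $(a,b,c,\alpha,\beta,\gamma,d)$ with $a^2+b^2=\gamma^2$, $b^2+c^2=\alpha^2$, $c^2+a^2=\beta^2$, $a^2+b^2+c^2=d^2$ (these letters are unrelated to the integer unknowns $a,b,c,u$ of the claim). Let $D_{uz}=\{(u,z)\in\mathbb{R}^2: 0<u<1,\ 0<z<1\}$. Define $f\colon D_{uz}\to\mathbb{R}^2$ by $f(u,z)=(a(u,z),b(u,z))$, where $a(u,z)$ and $b(u,z)$ are the positive real numbers determined by $$a^2=\frac{u^2+z^2}{u^2z^2+1},\qquad b^2=\frac{(1+u^2)(1+z^2)-2z(1-u^2)}{(1+u^2)(1+z^2)+2z(1-u^2)}$$ (both right-hand sides are positive on $D_{uz}$), and let $D_{ab}=f(D_{uz})$. -}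

module Defs where

open import Data.Nat.Base as ℕ using (ℕ)
import Data.Nat.Properties as ℕ
open import Data.Integer.Base as ℤ using (ℤ; 0ℤ)
import Data.Integer.Properties as ℤ
open import Data.Rational.Base
open import Data.Rational.Properties
open import Data.Rational.Solver
open import Data.Product.Base using (Σ-syntax; ∃₂; ∃-syntax; _×_; _,_)
open import Relation.Binary.PropositionalEquality
open import Relation.Nullary.Decidable.Core using (yes; no)
open import Relation.Nullary.Negation.Core using (contradiction)

open +-*-Solver

-- ℝ is the setoid of Cauchy sequences of rationals under _≈ʳ_ below.

record ℝ : Set where
  constructor mkℝ
  field
    seq    : ℕ → ℚ
    cauchy : ∀ ε → 0ℚ < ε →
             ∃[ N ] (∀ m n → N ℕ.≤ m → N ℕ.≤ n → ∣ seq m - seq n ∣ < ε)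

open ℝ public

infix 4 _≈ʳ_ _<ʳ_

_≈ʳ_ : ℝ → ℝ → Set
x ≈ʳ y = ∀ ε → 0ℚ < ε → ∃[ N ] (∀ n → N ℕ.≤ n → ∣ seq x n - seq y n ∣ < ε)

-- The gap ε must be uniform: termwise seq x n < seq y n would also hold for
-- some x and y with the same limit.
_<ʳ_ : ℝ → ℝ → Set
x <ʳ y = Σ[ ε ∈ ℚ ] 0ℚ < ε × ∃[ N ] (∀ n → N ℕ.≤ n → ε ≤ seq y n - seq x n)

fromℚ : ℚ → ℝ
fromℚ q = mkℝ (λ _ → q) λ ε 0<ε →
  0 , λ _ _ _ _ → subst (λ t → ∣ t ∣ < ε) (sym (+-inverseʳ q)) 0<ε

0ʳ 1ʳ 2ʳ : ℝ
0ʳ = fromℚ 0ℚ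
1ʳ = fromℚ 1ℚ
2ʳ = fromℚ (1ℚ + 1ℚ)

*-pos : ∀ {p q} → 0ℚ < p → 0ℚ < q → 0ℚ < p * q
*-pos {p} {q} 0<p 0<q =
  positive⁻¹ (p * q) {{pos*pos⇒pos p {{positive 0<p}} q {{positive 0<q}}}}

*-mono-≤-nonNeg : ∀ {p q r s} → 0ℚ ≤ r → 0ℚ ≤ q → p ≤ q → r ≤ s → p * r ≤ q * s
*-mono-≤-nonNeg {p} {q} {r} {s} 0≤r 0≤q p≤q r≤s = ≤-trans
  (*-monoʳ-≤-nonNeg r {{nonNegative 0≤r}} p≤q)
  (*-monoˡ-≤-nonNeg q {{nonNegative 0≤q}} r≤s)

half+half : ∀ ε → ½ * ε + ½ * ε ≡ ε
half+half ε = trans (sym (*-distribʳ-+ ε ½ ½)) (*-identityˡ ε)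

0<½ : 0ℚ < ½
0<½ = positive⁻¹ ½

0<1 : 0ℚ < 1ℚ
0<1 = positive⁻¹ 1ℚ

∣p-q∣≡∣q-p∣ : ∀ p q → ∣ p - q ∣ ≡ ∣ q - p ∣
∣p-q∣≡∣q-p∣ p q = trans (sym (∣-p∣≡∣p∣ (p - q)))
  (cong ∣_∣ (solve 2 (λ p q → :- (p :- q) := q :- p) refl p q))

inverse-pos : ∀ {p} → 0ℚ < p → Σ[ r ∈ ℚ ] 0ℚ < r × p * r ≡ 1ℚ
inverse-pos {p} 0<p = 1/ p , positive⁻¹ (1/ p) {{1/pos⇒pos p}} , *-inverseʳ p
  where
  instance
    p>0 : Positive p
    p>0 = positive 0<p
    p≢0 : NonZero p
    p≢0 = pos⇒nonZero p

split-ε : ∀ B C ε r → (B + C) * r ≡ 1ℚ → B * (ε * r) + C * (ε * r) ≡ ε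
split-ε B C ε r [B+C]r≡1 = begin
  B * (ε * r) + C * (ε * r)
    ≡⟨ solve 4 (λ b c e r → b :* (e :* r) :+ c :* (e :* r) := e :* ((b :+ c) :* r))
         refl B C ε r ⟩
  ε * ((B + C) * r)
    ≡⟨ cong (ε *_) [B+C]r≡1 ⟩
  ε * 1ℚ
    ≡⟨ *-identityʳ ε ⟩
  ε ∎
  where open ≡-Reasoning

product-distance : ∀ a b c d →
  ∣ a * b - c * d ∣ ≤ ∣ a ∣ * ∣ b - d ∣ + ∣ d ∣ * ∣ a - c ∣
product-distance a b c d = begin
  ∣ a * b - c * d ∣
    ≡⟨ cong ∣_∣ (solve 4 (λ a b c d → a :* b :- c :* d := a :* (b :- d) :+ d :* (a :- c))
         refl a b c d) ⟩
  ∣ a * (b - d) + d * (a - c) ∣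
    ≤⟨ ∣p+q∣≤∣p∣+∣q∣ (a * (b - d)) (d * (a - c)) ⟩
  ∣ a * (b - d) ∣ + ∣ d * (a - c) ∣
    ≡⟨ cong₂ _+_ (∣p*q∣≡∣p∣*∣q∣ a (b - d)) (∣p*q∣≡∣p∣*∣q∣ d (a - c)) ⟩
  ∣ a ∣ * ∣ b - d ∣ + ∣ d ∣ * ∣ a - c ∣ ∎
  where open ≤-Reasoning

weaken-bounds : ∀ {a b B C d e} → 0ℚ ≤ d → 0ℚ ≤ e → a ≤ B → b ≤ C →
                a * d + b * e ≤ B * d + C * e
weaken-bounds {d = d} {e} 0≤d 0≤e a≤B b≤C = +-mono-≤
  (*-monoʳ-≤-nonNeg d {{nonNegative 0≤d}} a≤B)
  (*-monoʳ-≤-nonNeg e {{nonNegative 0≤e}} b≤C)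

weaken-distances : ∀ {B C d e δ} → 0ℚ < B → 0ℚ < C → d < δ → e < δ →
                   B * d + C * e < B * δ + C * δ
weaken-distances {B} {C} 0<B 0<C d<δ e<δ = +-mono-<
  (*-monoʳ-<-pos B {{positive 0<B}} d<δ)
  (*-monoʳ-<-pos C {{positive 0<C}} e<δ)

bounded : ∀ x → Σ[ B ∈ ℚ ] 0ℚ < B × ∃[ N ] (∀ n → N ℕ.≤ n → ∣ seq x n ∣ ≤ B)
bounded x with cauchy x 1ℚ 0<1
... | N , close = 1ℚ + ∣ seq x N ∣ , +-mono-<-≤ 0<1 (0≤∣p∣ (seq x N)) , N , bound
  where
  bound : ∀ n → N ℕ.≤ n → ∣ seq x n ∣ ≤ 1ℚ + ∣ seq x N ∣
  bound n N≤n = begin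
    ∣ seq x n ∣
      ≡⟨ cong ∣_∣ (solve 2 (λ p q → p := (p :- q) :+ q) refl (seq x n) (seq x N)) ⟩
    ∣ (seq x n - seq x N) + seq x N ∣
      ≤⟨ ∣p+q∣≤∣p∣+∣q∣ (seq x n - seq x N) (seq x N) ⟩
    ∣ seq x n - seq x N ∣ + ∣ seq x N ∣
      ≤⟨ +-monoˡ-≤ ∣ seq x N ∣ (<⇒≤ (close n N N≤n ℕ.≤-refl)) ⟩
    1ℚ + ∣ seq x N ∣ ∎
    where open ≤-Reasoning

infixl 6 _+ʳ_ _-ʳ_
infixl 7 _*ʳ_ _÷ʳ_⟨_⟩
infix  8 -ʳ_
infix  9 _²

_+ʳ_ : ℝ → ℝ → ℝ
x +ʳ y = mkℝ (λ n → seq x n + seq y n) prf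
  where
  prf : ∀ ε → 0ℚ < ε → ∃[ N ] (∀ m n → N ℕ.≤ m → N ℕ.≤ n →
        ∣ (seq x m + seq y m) - (seq x n + seq y n) ∣ < ε)
  prf ε 0<ε with cauchy x (½ * ε) (*-pos 0<½ 0<ε) | cauchy y (½ * ε) (*-pos 0<½ 0<ε)
  ... | N₁ , c₁ | N₂ , c₂ = N₁ ℕ.⊔ N₂ , λ m n N≤m N≤n → begin-strict
      ∣ (seq x m + seq y m) - (seq x n + seq y n) ∣
        ≡⟨ cong ∣_∣ (solve 4 (λ a b c d → (a :+ b) :- (c :+ d) := (a :- c) :+ (b :- d))
             refl (seq x m) (seq y m) (seq x n) (seq y n)) ⟩
      ∣ (seq x m - seq x n) + (seq y m - seq y n) ∣
        ≤⟨ ∣p+q∣≤∣p∣+∣q∣ (seq x m - seq x n) (seq y m - seq y n) ⟩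
      ∣ seq x m - seq x n ∣ + ∣ seq y m - seq y n ∣
        <⟨ +-mono-< (c₁ m n (ℕ.m⊔n≤o⇒m≤o N₁ N₂ N≤m) (ℕ.m⊔n≤o⇒m≤o N₁ N₂ N≤n))
                    (c₂ m n (ℕ.m⊔n≤o⇒n≤o N₁ N₂ N≤m) (ℕ.m⊔n≤o⇒n≤o N₁ N₂ N≤n)) ⟩
      ½ * ε + ½ * ε
        ≡⟨ half+half ε ⟩
      ε ∎
    where open ≤-Reasoning

-ʳ_ : ℝ → ℝ
-ʳ x = mkℝ (λ n → - seq x n) prf
  where
  prf : ∀ ε → 0ℚ < ε → ∃[ N ] (∀ m n → N ℕ.≤ m → N ℕ.≤ n →
        ∣ - seq x m - - seq x n ∣ < ε)
  prf ε 0<ε with cauchy x ε 0<ε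
  ... | N , c = N , λ m n N≤m N≤n → subst (_< ε)
    (cong ∣_∣ (solve 2 (λ p q → q :- p := :- p :- (:- q)) refl (seq x m) (seq x n)))
    (c n m N≤n N≤m)

_-ʳ_ : ℝ → ℝ → ℝ
x -ʳ y = x +ʳ (-ʳ y)

Bound : (ℕ → ℚ) → ℚ → ℕ → Set
Bound s B K = ∀ n → K ℕ.≤ n → ∣ s n ∣ ≤ B

Close : (ℕ → ℚ) → ℚ → ℕ → Set
Close s ε N = ∀ m n → N ℕ.≤ m → N ℕ.≤ n → ∣ s m - s n ∣ < ε

*-close : ∀ s t {B C K L r ε N₁ N₂} →
          0ℚ < B → Bound s B K → 0ℚ < C → Bound t C L → (B + C) * r ≡ 1ℚ →
          Close s (ε * r) N₁ → Close t (ε * r) N₂ →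
          Close (λ n → s n * t n) ε ((K ℕ.⊔ L) ℕ.⊔ (N₁ ℕ.⊔ N₂))
*-close s t {B} {C} {K} {L} {r} {ε} {N₁} {N₂}
        0<B s≤B 0<C t≤C [B+C]r≡1 c₁ c₂ m n N≤m N≤n = begin-strict
  ∣ s m * t m - s n * t n ∣
    ≤⟨ product-distance (s m) (t m) (s n) (t n) ⟩
  ∣ s m ∣ * ∣ t m - t n ∣ + ∣ t n ∣ * ∣ s m - s n ∣
    ≤⟨ weaken-bounds (0≤∣p∣ (t m - t n)) (0≤∣p∣ (s m - s n))
         (s≤B m (ℕ.m⊔n≤o⇒m≤o K L KL≤m)) (t≤C n (ℕ.m⊔n≤o⇒n≤o K L KL≤n)) ⟩
  B * ∣ t m - t n ∣ + C * ∣ s m - s n ∣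
    <⟨ weaken-distances 0<B 0<C
         (c₂ m n (ℕ.m⊔n≤o⇒n≤o N₁ N₂ NN≤m) (ℕ.m⊔n≤o⇒n≤o N₁ N₂ NN≤n))
         (c₁ m n (ℕ.m⊔n≤o⇒m≤o N₁ N₂ NN≤m) (ℕ.m⊔n≤o⇒m≤o N₁ N₂ NN≤n)) ⟩
  B * (ε * r) + C * (ε * r)
    ≡⟨ split-ε B C ε r [B+C]r≡1 ⟩
  ε ∎
  where
  open ≤-Reasoning
  KL≤m = ℕ.m⊔n≤o⇒m≤o (K ℕ.⊔ L) (N₁ ℕ.⊔ N₂) N≤m
  KL≤n = ℕ.m⊔n≤o⇒m≤o (K ℕ.⊔ L) (N₁ ℕ.⊔ N₂) N≤n
  NN≤m = ℕ.m⊔n≤o⇒n≤o (K ℕ.⊔ L) (N₁ ℕ.⊔ N₂) N≤m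
  NN≤n = ℕ.m⊔n≤o⇒n≤o (K ℕ.⊔ L) (N₁ ℕ.⊔ N₂) N≤n

_*ʳ_ : ℝ → ℝ → ℝ
x *ʳ y = mkℝ (λ n → seq x n * seq y n) λ ε 0<ε →
  let B , 0<B , _ , x≤B = bounded x
      C , 0<C , _ , y≤C = bounded y
      r , 0<r , [B+C]r≡1 = inverse-pos (+-mono-< 0<B 0<C)
      _ , c₁ = cauchy x (ε * r) (*-pos 0<ε 0<r)
      _ , c₂ = cauchy y (ε * r) (*-pos 0<ε 0<r)
  in _ , *-close (seq x) (seq y) 0<B x≤B 0<C y≤C [B+C]r≡1 c₁ c₂

_² : ℝ → ℝ
x ² = x *ʳ x

-- The value at 0 is never used in the limit: a positive real has only
-- finitely many zero terms.
recip : ℚ → ℚ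
recip q with q ≟ 0ℚ
... | yes _   = 0ℚ
... | no  q≢0 = (1/ q) {{≢-nonZero q≢0}}

recip-inverseˡ : ∀ q → 0ℚ < q → recip q * q ≡ 1ℚ
recip-inverseˡ q 0<q with q ≟ 0ℚ
... | yes q≡0 = contradiction (sym q≡0) (<⇒≢ 0<q)
... | no  q≢0 = *-inverseˡ q {{≢-nonZero q≢0}}

recip-distance : ∀ {p q ε} → 0ℚ < ε → ε ≤ p → ε ≤ q →
                 ∣ recip p - recip q ∣ * (ε * ε) ≤ ∣ p - q ∣
recip-distance {p} {q} {ε} 0<ε ε≤p ε≤q = begin
  ∣ r - s ∣ * (ε * ε)
    ≤⟨ *-monoˡ-≤-nonNeg ∣ r - s ∣ {{nonNegative (0≤∣p∣ (r - s))}}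
         (*-mono-≤-nonNeg (<⇒≤ 0<ε) (<⇒≤ 0<p) ε≤p ε≤q) ⟩
  ∣ r - s ∣ * (p * q)
    ≡⟨ cong (∣ r - s ∣ *_) (sym (0≤p⇒∣p∣≡p (<⇒≤ (*-pos 0<p 0<q)))) ⟩
  ∣ r - s ∣ * ∣ p * q ∣
    ≡⟨ sym (∣p*q∣≡∣p∣*∣q∣ (r - s) (p * q)) ⟩
  ∣ (r - s) * (p * q) ∣
    ≡⟨ cong ∣_∣ (solve 4 (λ r s p q → (r :- s) :* (p :* q) := (r :* p) :* q :- (s :* q) :* p)
         refl r s p q) ⟩
  ∣ (r * p) * q - (s * q) * p ∣
    ≡⟨ cong₂ (λ t u → ∣ t * q - u * p ∣) (recip-inverseˡ p 0<p) (recip-inverseˡ q 0<q) ⟩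
  ∣ 1ℚ * q - 1ℚ * p ∣
    ≡⟨ cong₂ (λ t u → ∣ t - u ∣) (*-identityˡ q) (*-identityˡ p) ⟩
  ∣ q - p ∣
    ≡⟨ ∣p-q∣≡∣q-p∣ q p ⟩
  ∣ p - q ∣ ∎
  where
  open ≤-Reasoning
  r = recip p
  s = recip q
  0<p = <-≤-trans 0<ε ε≤p
  0<q = <-≤-trans 0<ε ε≤q

inv : ∀ x → 0ʳ <ʳ x → ℝ
inv x (ε , 0<ε , K , ε≤x-0) = mkℝ (λ n → recip (seq x n)) λ η 0<η →
  let N , c = cauchy x (η * (ε * ε)) (*-pos 0<η 0<ε²)
  in K ℕ.⊔ N , λ m n N≤m N≤n →
    *-cancelʳ-<-nonNeg (ε * ε) {{nonNegative (<⇒≤ 0<ε²)}} (≤-<-trans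
      (recip-distance 0<ε
        (ε≤x m (ℕ.m⊔n≤o⇒m≤o K N N≤m)) (ε≤x n (ℕ.m⊔n≤o⇒m≤o K N N≤n)))
      (c m n (ℕ.m⊔n≤o⇒n≤o K N N≤m) (ℕ.m⊔n≤o⇒n≤o K N N≤n)))
  where
  ε≤x : ∀ n → K ℕ.≤ n → ε ≤ seq x n
  ε≤x n K≤n = subst (ε ≤_) (+-identityʳ (seq x n)) (ε≤x-0 n K≤n)

  0<ε² : 0ℚ < ε * ε
  0<ε² = *-pos 0<ε 0<ε

_÷ʳ_⟨_⟩ : (x y : ℝ) → 0ʳ <ʳ y → ℝ
x ÷ʳ y ⟨ 0<y ⟩ = x *ʳ inv y 0<y

0<1ʳ : 0ʳ <ʳ 1ʳ
0<1ʳ = 1ℚ , 0<1 , 0 , λ _ _ → ≤-refl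

0<2ʳ : 0ʳ <ʳ 2ʳ
0<2ʳ = 1ℚ + 1ℚ , +-mono-< 0<1 0<1 , 0 , λ _ _ → ≤-refl

+ʳ-pos : ∀ {x y} → 0ʳ <ʳ x → 0ʳ <ʳ y → 0ʳ <ʳ x +ʳ y
+ʳ-pos {x} {y} (ε , 0<ε , K , ε≤x) (δ , 0<δ , L , δ≤y) =
  ε + δ , +-mono-< 0<ε 0<δ , K ℕ.⊔ L , λ n N≤n → subst (ε + δ ≤_)
    (solve 2 (λ p q → (p :- con 0ℚ) :+ (q :- con 0ℚ) := (p :+ q) :- con 0ℚ)
       refl (seq x n) (seq y n))
    (+-mono-≤ (ε≤x n (ℕ.m⊔n≤o⇒m≤o K L N≤n)) (δ≤y n (ℕ.m⊔n≤o⇒n≤o K L N≤n)))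

*ʳ-pos : ∀ {x y} → 0ʳ <ʳ x → 0ʳ <ʳ y → 0ʳ <ʳ x *ʳ y
*ʳ-pos {x} {y} (ε , 0<ε , K , ε≤x) (δ , 0<δ , L , δ≤y) =
  ε * δ , *-pos 0<ε 0<δ , K ℕ.⊔ L , λ n N≤n →
    let ε≤xn = ε≤x n (ℕ.m⊔n≤o⇒m≤o K L N≤n)
        δ≤yn = δ≤y n (ℕ.m⊔n≤o⇒n≤o K L N≤n)
    in subst (ε * δ ≤_)
      (solve 2 (λ p q → (p :- con 0ℚ) :* (q :- con 0ℚ) := (p :* q) :- con 0ℚ)
         refl (seq x n) (seq y n))
      (*-mono-≤-nonNeg (<⇒≤ 0<δ) (≤-trans (<⇒≤ 0<ε) ε≤xn) ε≤xn δ≤yn)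

0<1-x² : ∀ {x} → 0ʳ <ʳ x → x <ʳ 1ʳ → 0ʳ <ʳ 1ʳ -ʳ x ²
0<1-x² {x} (ε , 0<ε , K , ε≤x) (δ , 0<δ , L , δ≤1-x) =
  δ , 0<δ , K ℕ.⊔ L , λ n N≤n →
    let 0≤xn   = subst (0ℚ ≤_) (+-identityʳ (seq x n))
                   (≤-trans (<⇒≤ 0<ε) (ε≤x n (ℕ.m⊔n≤o⇒m≤o K L N≤n)))
        δ≤1-xn = δ≤1-x n (ℕ.m⊔n≤o⇒n≤o K L N≤n)
        0≤1-xn = ≤-trans (<⇒≤ 0<δ) δ≤1-xn
    in subst₂ _≤_ (*-identityʳ δ)
      (solve 1 (λ p → (con 1ℚ :- p) :* (con 1ℚ :+ p) := (con 1ℚ :- p :* p) :- con 0ℚ)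
         refl (seq x n))
      (*-mono-≤-nonNeg (<⇒≤ 0<1) 0≤1-xn δ≤1-xn
         (subst (_≤ 1ℚ + seq x n) (+-identityʳ 1ℚ) (+-monoʳ-≤ 1ℚ 0≤xn)))

record D-uz (u z : ℝ) : Set where
  field
    0<u : 0ʳ <ʳ u
    u<1 : u <ʳ 1ʳ
    0<z : 0ʳ <ʳ z
    z<1 : z <ʳ 1ʳ

module _ {u z : ℝ} (uz∈D : D-uz u z) where
  open D-uz uz∈D

  a²-denominator-pos : 0ʳ <ʳ u ² *ʳ z ² +ʳ 1ʳ
  a²-denominator-pos = +ʳ-pos {u ² *ʳ z ²} {1ʳ}
    (*ʳ-pos {u ²} {z ²} (*ʳ-pos {u} {u} 0<u 0<u) (*ʳ-pos {z} {z} 0<z 0<z)) 0<1ʳ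

  b²-denominator-pos : 0ʳ <ʳ (1ʳ +ʳ u ²) *ʳ (1ʳ +ʳ z ²) +ʳ 2ʳ *ʳ z *ʳ (1ʳ -ʳ u ²)
  b²-denominator-pos =
    +ʳ-pos {(1ʳ +ʳ u ²) *ʳ (1ʳ +ʳ z ²)} {2ʳ *ʳ z *ʳ (1ʳ -ʳ u ²)}
      (*ʳ-pos {1ʳ +ʳ u ²} {1ʳ +ʳ z ²}
        (+ʳ-pos {1ʳ} {u ²} 0<1ʳ (*ʳ-pos {u} {u} 0<u 0<u))
        (+ʳ-pos {1ʳ} {z ²} 0<1ʳ (*ʳ-pos {z} {z} 0<z 0<z)))
      (*ʳ-pos {2ʳ *ʳ z} {1ʳ -ʳ u ²} (*ʳ-pos {2ʳ} {z} 0<2ʳ 0<z) (0<1-x² {u} 0<u u<1))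

  a²-value b²-value : ℝ
  a²-value = (u ² +ʳ z ²) ÷ʳ (u ² *ʳ z ² +ʳ 1ʳ) ⟨ a²-denominator-pos ⟩
  b²-value = ((1ʳ +ʳ u ²) *ʳ (1ʳ +ʳ z ²) -ʳ 2ʳ *ʳ z *ʳ (1ʳ -ʳ u ²))
          ÷ʳ ((1ʳ +ʳ u ²) *ʳ (1ʳ +ʳ z ²) +ʳ 2ʳ *ʳ z *ʳ (1ʳ -ʳ u ²))
           ⟨ b²-denominator-pos ⟩

  -- The graph of f: f(u , z) = (a , b), where a and b are determined as the
  -- positive reals with the given squares.
  record f-value (a b : ℝ) : Set where
    field
      0<a : 0ʳ <ʳ a
      0<b : 0ʳ <ʳ b
      a²≈ : a ² ≈ʳ a²-value
      b²≈ : b ² ≈ʳ b²-value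

D-ab : ℝ → ℝ → Set
D-ab a b = ∃₂ λ u z → Σ[ uz∈D ∈ D-uz u z ] f-value uz∈D a b

infixl 7 _/_⟨_⟩

-- ∣ c ∣ is c itself, since c is positive.
_/_⟨_⟩ : (n c : ℤ) → 0ℤ ℤ.< c → ℚ
n / c ⟨ 0<c ⟩ = (n / ℤ.∣ c ∣) {{ℤ.>-nonZero 0<c}}

record PerfectCuboid : Set where
  field
    a b c α β γ d : ℕ
    0<a : 0 ℕ.< a
    0<b : 0 ℕ.< b
    0<c : 0 ℕ.< c
    0<α : 0 ℕ.< α
    0<β : 0 ℕ.< β
    0<γ : 0 ℕ.< γ
    0<d : 0 ℕ.< d
    a²+b²≡γ²    : a ℕ.^ 2 ℕ.+ b ℕ.^ 2 ≡ γ ℕ.^ 2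
    b²+c²≡α²    : b ℕ.^ 2 ℕ.+ c ℕ.^ 2 ≡ α ℕ.^ 2
    c²+a²≡β²    : c ℕ.^ 2 ℕ.+ a ℕ.^ 2 ≡ β ℕ.^ 2
    a²+b²+c²≡d² : a ℕ.^ 2 ℕ.+ b ℕ.^ 2 ℕ.+ c ℕ.^ 2 ≡ d ℕ.^ 2

{-# OPTIONS --safe #-}

-- Divide a perfect cuboid (x , y , z) by its space diagonal d. The pairs
-- (x , α), (y , β), (γ , z), divided by d, are the cosine and sine of angles
-- whose half-angle tangents a/c, b/c, u/c are rational and lie in (0 , 1).
-- Conversely three such tangents give a cuboid with rational edges and face
-- diagonals as soon as the squares of the edges add up to d², and up to clearing
-- denominators the equation of degree 12 is x² + y² + z² = d².
--
-- For a cuboid, (a/c , b/c) = f(u/c , y/(γ + x)), where y/(γ + x) belongs to the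
-- angle in the face with edges x and y: the conditions of f say that x/d and y/d
-- are γ/d times the cosine and sine of that angle. In the other direction D-ab
-- only enters through 0 < a/c < 1 and 0 < b/c < 1, and u/c need not be the u for
-- which f(u , z) = (a/c , b/c).

module Submission where

open import Defs
open import Algebra.Bundles using (module AbelianGroup)
open import Algebra.Properties.Group using (∙-cancelʳ)
open import Data.Integer.Base using (ℤ; 0ℤ; +_; +<+; _+_; _-_; -_; _*_; _^_; _<_; ∣_∣; >-nonZero)
import Data.Integer.Properties as ℤ
import Data.Integer.Solver as ℤ-Solver
open import Data.Nat.Base as ℕ using (s≤s)
import Data.Nat.Properties as ℕ
open import Data.Product.Base using (∃-syntax; Σ-syntax; _×_; _,_; proj₁; proj₂)
open import Data.Rational.Base as ℚ using (ℚ; 0ℚ; 1ℚ; fromℚᵘ)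
import Data.Rational.Properties as ℚ
import Data.Rational.Solver as ℚ-Solver
open import Data.Rational.Unnormalised.Base as ℚᵘ using (mkℚᵘ; *≡*; *<*)
import Data.Rational.Unnormalised.Properties as ℚᵘ
open import Data.Sum.Base using (inj₁; inj₂)
open import Function.Base using (_$_; id)
open import Function.Bundles using (_⇔_; mk⇔)
open import Relation.Binary.PropositionalEquality

open ≡-Reasoning

-- The polynomial of degree 12 as a defect of squares

-- The operations are parameters so that the same expression denotes the integer
-- and the ring solver's syntax; the powers are parameters because the solver is
-- too slow unless the polynomial is taken in the squares of the unknowns.
module _ {A : Set} (_⊕_ _⊖_ _⊛_ : A → A → A) (κ : ℤ → A) where
  private
    infixl 7 _·_
    infixl 6 _⊞_ _⊟_

    _⊞_ _⊟_ _·_ : A → A → A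
    _⊞_ = _⊕_
    _⊟_ = _⊖_
    _·_ = _⊛_

  polynomial : (a² b² u² c² a⁴ b⁴ u⁴ c⁴ c⁶ c⁸ c¹⁰ c¹² : A) → A
  polynomial a² b² u² c² a⁴ b⁴ u⁴ c⁴ c⁶ c⁸ c¹⁰ c¹² =
    u⁴ · a⁴ · b⁴ ⊞ κ (+ 6) · a⁴ · u² · b⁴ · c²
    ⊟ κ (+ 2) · u⁴ · a⁴ · b² · c² ⊟ κ (+ 2) · u⁴ · a² · b⁴ · c²
    ⊞ κ (+ 4) · u² · b⁴ · a² · c⁴ ⊞ κ (+ 4) · a⁴ · u² · b² · c⁴
    ⊟ κ (+ 12) · u⁴ · a² · b² · c⁴
    ⊞ u⁴ · a⁴ · c⁴ ⊞ u⁴ · b⁴ · c⁴ ⊞ a⁴ · b⁴ · c⁴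
    ⊞ κ (+ 6) · a⁴ · u² · c⁶ ⊞ κ (+ 6) · u² · b⁴ · c⁶
    ⊟ κ (+ 8) · a² · b² · u² · c⁶
    ⊟ κ (+ 2) · u⁴ · a² · c⁶ ⊟ κ (+ 2) · u⁴ · b² · c⁶
    ⊟ κ (+ 2) · a⁴ · b² · c⁶ ⊟ κ (+ 2) · b⁴ · a² · c⁶
    ⊞ u⁴ · c⁸ ⊞ b⁴ · c⁸ ⊞ a⁴ · c⁸
    ⊞ κ (+ 4) · a² · u² · c⁸ ⊞ κ (+ 4) · b² · u² · c⁸
    ⊟ κ (+ 12) · b² · a² · c⁸
    ⊞ κ (+ 6) · u² · c¹⁰ ⊟ κ (+ 2) · a² · c¹⁰ ⊟ κ (+ 2) · b² · c¹⁰
    ⊞ c¹²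

cuboid-polynomial : (a b c u : ℤ) → ℤ
cuboid-polynomial a b c u = polynomial _+_ _-_ _*_ id
  (a ^ 2) (b ^ 2) (u ^ 2) (c ^ 2)
  (a ^ 4) (b ^ 4) (u ^ 4) (c ^ 4) (c ^ 6) (c ^ 8) (c ^ 10) (c ^ 12)

module _ where
  open ℤ-Solver.+-*-Solver

  -- The letters stand for the squares of the unknowns. The factor `2uc` of the third edge is not a
  -- polynomial in these squares, so `z` omits it and it enters as its square, `4 * u * c`.
  polynomial-in-squares : ∀ a b c u →
    let x = (c - a) * ((c + b) * (c + u))
        y = (c - b) * ((c + a) * (c + u))
        z = (c + a) * (c + b)
        d = (c + a) * ((c + b) * (c + u))
    in polynomial _+_ _-_ _*_ id a b u c
         (a ^ 2) (b ^ 2) (u ^ 2) (c ^ 2) (c ^ 3) (c ^ 4) (c ^ 5) (c ^ 6)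
       ≡ x * x + y * y + + 4 * u * c * (z * z) - d * d
  polynomial-in-squares = solve 4 (λ a b c u →
    let x = (c :- a) :* ((c :+ b) :* (c :+ u))
        y = (c :- b) :* ((c :+ a) :* (c :+ u))
        z = (c :+ a) :* (c :+ b)
        d = (c :+ a) :* ((c :+ b) :* (c :+ u))
    in polynomial _:+_ _:-_ _:*_ con a b u c
         (a :^ 2) (b :^ 2) (u :^ 2) (c :^ 2) (c :^ 3) (c :^ 4) (c :^ 5) (c :^ 6)
       := x :* x :+ y :* y :+ con (+ 4) :* u :* c :* (z :* z) :- d :* d) refl

-- If `p / c` is the tangent of half an angle, the cosine and sine of the angle are the two
-- numerators over `denominator p c`.
cos-numerator sin-numerator denominator : ℤ → ℤ → ℤ
cos-numerator p c = c ^ 2 - p ^ 2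
sin-numerator p c = + 2 * p * c
denominator p c = c ^ 2 + p ^ 2

-- Over the common denominator `cuboid-d`, these are the cosines of the angles of `a / c` and
-- `b / c` and the sine of the angle of `u / c`.
cuboid-x cuboid-y cuboid-z cuboid-d : (a b c u : ℤ) → ℤ
cuboid-x a b c u = cos-numerator a c * (denominator b c * denominator u c)
cuboid-y a b c u = cos-numerator b c * (denominator a c * denominator u c)
cuboid-z a b c u = sin-numerator u c * (denominator a c * denominator b c)
cuboid-d a b c u = denominator a c * (denominator b c * denominator u c)

cuboid-polynomial≡defect : ∀ a b c u →
  let x = cuboid-x a b c u
      y = cuboid-y a b c u
      z = cuboid-z a b c u
      d = cuboid-d a b c u
  in cuboid-polynomial a b c u ≡ x * x + y * y + z * z - d * d
cuboid-polynomial≡defect a b c u = begin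
  cuboid-polynomial a b c u
    -- Only even powers occur, so every power can be rewritten as a power of a square.
    ≡⟨ cong (polynomial _+_ _-_ _*_ id (a ^ 2) (b ^ 2) (u ^ 2) (c ^ 2))
         (power a 2) ⟨$⟩ power b 2 ⟨$⟩ power u 2
         ⟨$⟩ power c 2 ⟨$⟩ power c 3 ⟨$⟩ power c 4 ⟨$⟩ power c 5 ⟨$⟩ power c 6 ⟩
  polynomial _+_ _-_ _*_ id (a ^ 2) (b ^ 2) (u ^ 2) (c ^ 2)
    ((a ^ 2) ^ 2) ((b ^ 2) ^ 2) ((u ^ 2) ^ 2)
    ((c ^ 2) ^ 2) ((c ^ 2) ^ 3) ((c ^ 2) ^ 4) ((c ^ 2) ^ 5) ((c ^ 2) ^ 6)
    ≡⟨ polynomial-in-squares (a ^ 2) (b ^ 2) (c ^ 2) (u ^ 2) ⟩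
  x * x + y * y + + 4 * u ^ 2 * c ^ 2 * (w * w) - d * d
    ≡⟨ cong (λ t → x * x + y * y + t - d * d) (square-z u c w) ⟩
  x * x + y * y + z * z - d * d ∎
  where
  open ℤ-Solver.+-*-Solver
  x = cuboid-x a b c u
  y = cuboid-y a b c u
  z = cuboid-z a b c u
  d = cuboid-d a b c u
  w = denominator a c * denominator b c

  infixl 4 _⟨$⟩_
  _⟨$⟩_ : ∀ {A B : Set} {f g : A → B} {s t : A} → f ≡ g → s ≡ t → f s ≡ g t
  _⟨$⟩_ = cong₂ _$_

  power : ∀ i n → i ^ (2 ℕ.* n) ≡ (i ^ 2) ^ n
  power i n = sym (ℤ.^-*-assoc i 2 n)

  square-z : ∀ u c w →
    + 4 * u ^ 2 * c ^ 2 * (w * w) ≡ + 2 * u * c * w * (+ 2 * u * c * w)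
  square-z = solve 3 (λ u c w →
    con (+ 4) :* u :^ 2 :* c :^ 2 :* (w :* w)
    := con (+ 2) :* u :* c :* w :* (con (+ 2) :* u :* c :* w)) refl

-- Half-angle formulas over the integers

*-pos-ℤ : ∀ {i j} → 0ℤ < i → 0ℤ < j → 0ℤ < i * j
*-pos-ℤ (+<+ (s≤s _)) (+<+ (s≤s _)) = +<+ (s≤s ℕ.z≤n)

i<j⇒0<j-i : ∀ {i j} → i < j → 0ℤ < j - i
i<j⇒0<j-i {i} {j} i<j = subst (_< j - i) (ℤ.+-inverseʳ i) (ℤ.+-monoˡ-< (- i) i<j)

*-cancelˡ-pos : ∀ {i j k} → 0ℤ < i → i * j ≡ i * k → j ≡ k
*-cancelˡ-pos {i} 0<i = ℤ.*-cancelˡ-≡ i _ _ {{>-nonZero 0<i}}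

+[n^2] : ∀ n → + (n ℕ.^ 2) ≡ (+ n) ^ 2
+[n^2] n = begin
  + (n ℕ.* (n ℕ.* 1))
    ≡⟨ ℤ.pos-* n (n ℕ.* 1) ⟩
  + n * + (n ℕ.* 1)
    ≡⟨ cong (+ n *_) (ℤ.pos-* n 1) ⟩
  (+ n) ^ 2 ∎

-- With the angle t such that x = h cos t and l = h sin t, the ratio p / m is
-- tan (t / 2).
module HalfAngle {p m h l x : ℤ} (p[h+x]≡lm : p * (h + x) ≡ l * m)
                 (l²+x²≡h² : l ^ 2 + x ^ 2 ≡ h ^ 2) where
  open ℤ-Solver.+-*-Solver

  -- The hypotheses give `p² (h + x)² = (h² - x²) m²`. After multiplication by `(h + x)²`, both
  -- sides become `2 h x (h + x) m²`, and the positive factor `h + x` cancels twice.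
  half-angle-cos : 0ℤ < h + x → h * cos-numerator p m ≡ x * denominator p m
  half-angle-cos 0<h+x = *-cancelˡ-pos 0<h+x (*-cancelˡ-pos 0<h+x (begin
    (h + x) * ((h + x) * (h * cos-numerator p m))
      ≡⟨ solve 4 (λ p m h x →
           (h :+ x) :* ((h :+ x) :* (h :* (m :^ 2 :- p :^ 2)))
           := h :* (h :+ x) :^ 2 :* m :^ 2 :- h :* (p :* (h :+ x)) :^ 2) refl p m h x ⟩
    h * (h + x) ^ 2 * m ^ 2 - h * (p * (h + x)) ^ 2
      ≡⟨ cong (λ t → h * (h + x) ^ 2 * m ^ 2 - h * t ^ 2) p[h+x]≡lm ⟩
    h * (h + x) ^ 2 * m ^ 2 - h * (l * m) ^ 2
      -- `l ^ 2` is padded to `l ^ 2 + x ^ 2 - x ^ 2` so that the Pythagorean hypothesis can be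
      -- substituted.
      ≡⟨ solve 4 (λ m h l x →
           h :* (h :+ x) :^ 2 :* m :^ 2 :- h :* (l :* m) :^ 2
           := h :* (h :+ x) :^ 2 :* m :^ 2 :- h :* (l :^ 2 :+ x :^ 2 :- x :^ 2) :* m :^ 2)
           refl m h l x ⟩
    h * (h + x) ^ 2 * m ^ 2 - h * (l ^ 2 + x ^ 2 - x ^ 2) * m ^ 2
      ≡⟨ cong (λ t → h * (h + x) ^ 2 * m ^ 2 - h * (t - x ^ 2) * m ^ 2) l²+x²≡h² ⟩
    h * (h + x) ^ 2 * m ^ 2 - h * (h ^ 2 - x ^ 2) * m ^ 2
      ≡⟨ solve 3 (λ m h x →
           h :* (h :+ x) :^ 2 :* m :^ 2 :- h :* (h :^ 2 :- x :^ 2) :* m :^ 2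
           := x :* (h :+ x) :^ 2 :* m :^ 2 :+ x :* (h :^ 2 :- x :^ 2) :* m :^ 2) refl m h x ⟩
    x * (h + x) ^ 2 * m ^ 2 + x * (h ^ 2 - x ^ 2) * m ^ 2
      ≡⟨ cong (λ t → x * (h + x) ^ 2 * m ^ 2 + x * (t - x ^ 2) * m ^ 2) (sym l²+x²≡h²) ⟩
    x * (h + x) ^ 2 * m ^ 2 + x * (l ^ 2 + x ^ 2 - x ^ 2) * m ^ 2
      ≡⟨ solve 4 (λ m h l x →
           x :* (h :+ x) :^ 2 :* m :^ 2 :+ x :* (l :^ 2 :+ x :^ 2 :- x :^ 2) :* m :^ 2
           := x :* (h :+ x) :^ 2 :* m :^ 2 :+ x :* (l :* m) :^ 2) refl m h l x ⟩
    x * (h + x) ^ 2 * m ^ 2 + x * (l * m) ^ 2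
      ≡⟨ cong (λ t → x * (h + x) ^ 2 * m ^ 2 + x * t ^ 2) (sym p[h+x]≡lm) ⟩
    x * (h + x) ^ 2 * m ^ 2 + x * (p * (h + x)) ^ 2
      ≡⟨ solve 4 (λ p m h x →
           x :* (h :+ x) :^ 2 :* m :^ 2 :+ x :* (p :* (h :+ x)) :^ 2
           := (h :+ x) :* ((h :+ x) :* (x :* (m :^ 2 :+ p :^ 2)))) refl p m h x ⟩
    (h + x) * ((h + x) * (x * denominator p m)) ∎))

  -- This is `sin t = tan (t / 2) (1 + cos t)`, through `2 p m² = p (m² - p²) + p (m² + p²)`.
  half-angle-sin : 0ℤ < m → 0ℤ < h + x → h * sin-numerator p m ≡ l * denominator p m
  half-angle-sin 0<m 0<h+x = *-cancelˡ-pos 0<m (begin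
    m * (h * sin-numerator p m)
      ≡⟨ solve 3 (λ p m h →
           m :* (h :* (con (+ 2) :* p :* m))
           := p :* (h :* (m :^ 2 :- p :^ 2)) :+ p :* h :* (m :^ 2 :+ p :^ 2)) refl p m h ⟩
    p * (h * cos-numerator p m) + p * h * denominator p m
      ≡⟨ cong (λ t → p * t + p * h * denominator p m) (half-angle-cos 0<h+x) ⟩
    p * (x * denominator p m) + p * h * denominator p m
      ≡⟨ solve 4 (λ p h x e → p :* (x :* e) :+ p :* h :* e := p :* (h :+ x) :* e)
           refl p h x (denominator p m) ⟩
    p * (h + x) * denominator p m
      ≡⟨ cong (_* denominator p m) p[h+x]≡lm ⟩
    l * m * denominator p m
      ≡⟨ solve 3 (λ l m e → l :* m :* e := m :* (l :* e)) refl l m (denominator p m) ⟩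
    m * (l * denominator p m) ∎)

open HalfAngle

-- From a cuboid to a zero of the polynomial

cuboid-d-rotate₁ : ∀ a b c u →
  cuboid-d a b c u ≡ denominator b c * (denominator a c * denominator u c)
cuboid-d-rotate₁ a b c u =
  solve 3 (λ A B U → A :* (B :* U) := B :* (A :* U)) refl
    (denominator a c) (denominator b c) (denominator u c)
  where open ℤ-Solver.+-*-Solver

cuboid-d-rotate₂ : ∀ a b c u →
  cuboid-d a b c u ≡ denominator u c * (denominator a c * denominator b c)
cuboid-d-rotate₂ a b c u =
  solve 3 (λ A B U → A :* (B :* U) := U :* (A :* B)) refl
    (denominator a c) (denominator b c) (denominator u c)
  where open ℤ-Solver.+-*-Solver

-- The three ratios say that `(X , Y , Z , D)` is proportional to `(x , y , z , d)`. Hence `d²`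
-- times the defect of the former is `D²` times that of the latter, which is zero.
similar⇒cuboid-polynomial≡0 : ∀ {a b c u x y z d} → 0ℤ < d → x ^ 2 + y ^ 2 + z ^ 2 ≡ d ^ 2 →
  d * cos-numerator a c ≡ x * denominator a c →
  d * cos-numerator b c ≡ y * denominator b c →
  d * sin-numerator u c ≡ z * denominator u c →
  cuboid-polynomial a b c u ≡ 0ℤ
similar⇒cuboid-polynomial≡0 {a} {b} {c} {u} {x} {y} {z} {d}
  0<d x²+y²+z²≡d² x-ratio y-ratio z-ratio =
  *-cancelˡ-pos 0<d (*-cancelˡ-pos 0<d (begin
  d * (d * cuboid-polynomial a b c u)
    ≡⟨ cong (λ t → d * (d * t)) (cuboid-polynomial≡defect a b c u) ⟩
  d * (d * (X * X + Y * Y + Z * Z - D * D))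
    ≡⟨ solve 5 (λ d X Y Z D →
         d :* (d :* (X :* X :+ Y :* Y :+ Z :* Z :- D :* D))
         := (d :* X) :^ 2 :+ (d :* Y) :^ 2 :+ (d :* Z) :^ 2 :- d :^ 2 :* D :^ 2) refl d X Y Z D ⟩
  (d * X) ^ 2 + (d * Y) ^ 2 + (d * Z) ^ 2 - d ^ 2 * D ^ 2
    ≡⟨ cong₂ (λ s t → s ^ 2 + t ^ 2 + (d * Z) ^ 2 - d ^ 2 * D ^ 2) dX≡xD dY≡yD ⟩
  (x * D) ^ 2 + (y * D) ^ 2 + (d * Z) ^ 2 - d ^ 2 * D ^ 2
    ≡⟨ cong₂ (λ s t → (x * D) ^ 2 + (y * D) ^ 2 + s ^ 2 - t * D ^ 2) dZ≡zD (sym x²+y²+z²≡d²) ⟩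
  (x * D) ^ 2 + (y * D) ^ 2 + (z * D) ^ 2 - (x ^ 2 + y ^ 2 + z ^ 2) * D ^ 2
    -- Zero is written as `d * (d * 0ℤ)` to match the two cancellations of `d`.
    ≡⟨ solve 5 (λ d x y z D →
         (x :* D) :^ 2 :+ (y :* D) :^ 2 :+ (z :* D) :^ 2 :- (x :^ 2 :+ y :^ 2 :+ z :^ 2) :* D :^ 2
         := d :* (d :* con 0ℤ)) refl d x y z D ⟩
  d * (d * 0ℤ) ∎))
  where
  open ℤ-Solver.+-*-Solver
  X = cuboid-x a b c u
  Y = cuboid-y a b c u
  Z = cuboid-z a b c u
  D = cuboid-d a b c u

  rescaled : ∀ n x e k → d * n ≡ x * e → D ≡ e * k → d * (n * k) ≡ x * D
  rescaled n x e k dn≡xe D≡ek = begin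
    d * (n * k)
      ≡⟨ sym (ℤ.*-assoc d n k) ⟩
    d * n * k
      ≡⟨ cong (_* k) dn≡xe ⟩
    x * e * k
      ≡⟨ ℤ.*-assoc x e k ⟩
    x * (e * k)
      ≡⟨ cong (x *_) (sym D≡ek) ⟩
    x * D ∎

  dX≡xD = rescaled (cos-numerator a c) x (denominator a c) _ x-ratio refl
  dY≡yD = rescaled (cos-numerator b c) y (denominator b c) _ y-ratio (cuboid-d-rotate₁ a b c u)
  dZ≡zD = rescaled (sin-numerator u c) z (denominator u c) _ z-ratio (cuboid-d-rotate₂ a b c u)

-- Squares in `ℕ` and `ℤ`, and the cuboid built from a zero

sum-of-squares : ∀ m n → + (m ℕ.^ 2 ℕ.+ n ℕ.^ 2) ≡ (+ m) ^ 2 + (+ n) ^ 2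
sum-of-squares m n = trans (ℤ.pos-+ (m ℕ.^ 2) (n ℕ.^ 2)) (cong₂ _+_ (+[n^2] m) (+[n^2] n))

pythagoras-ℕ⇒ℤ : ∀ m n k → m ℕ.^ 2 ℕ.+ n ℕ.^ 2 ≡ k ℕ.^ 2 → (+ m) ^ 2 + (+ n) ^ 2 ≡ (+ k) ^ 2
pythagoras-ℕ⇒ℤ m n k m²+n²≡k² = begin
  (+ m) ^ 2 + (+ n) ^ 2
    ≡⟨ sym (sum-of-squares m n) ⟩
  + (m ℕ.^ 2 ℕ.+ n ℕ.^ 2)
    ≡⟨ cong +_ m²+n²≡k² ⟩
  + (k ℕ.^ 2)
    ≡⟨ +[n^2] k ⟩
  (+ k) ^ 2 ∎

pythagoras-ℤ⇒ℕ : ∀ m n k → (+ m) ^ 2 + (+ n) ^ 2 ≡ (+ k) ^ 2 → m ℕ.^ 2 ℕ.+ n ℕ.^ 2 ≡ k ℕ.^ 2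
pythagoras-ℤ⇒ℕ m n k m²+n²≡k² =
  ℤ.+-injective (trans (sum-of-squares m n) (trans m²+n²≡k² (sym (+[n^2] k))))

-- Matching on `+<+` exposes each integer as `+ n`, so the absolute values give back the same
-- numbers.
integral-cuboid : ∀ {a b c α β γ d} →
  0ℤ < a → 0ℤ < b → 0ℤ < c → 0ℤ < α → 0ℤ < β → 0ℤ < γ → 0ℤ < d →
  a ^ 2 + b ^ 2 ≡ γ ^ 2 → b ^ 2 + c ^ 2 ≡ α ^ 2 → c ^ 2 + a ^ 2 ≡ β ^ 2 →
  a ^ 2 + b ^ 2 + c ^ 2 ≡ d ^ 2 → PerfectCuboid
integral-cuboid {a} {b} {c} {α} {β} {γ} {d}
  (+<+ 0<a) (+<+ 0<b) (+<+ 0<c) (+<+ 0<α) (+<+ 0<β) (+<+ 0<γ) (+<+ 0<d) ab bc ca abc = record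
  { a = ∣ a ∣ ; b = ∣ b ∣ ; c = ∣ c ∣ ; α = ∣ α ∣ ; β = ∣ β ∣ ; γ = ∣ γ ∣ ; d = ∣ d ∣
  ; 0<a = 0<a ; 0<b = 0<b ; 0<c = 0<c ; 0<α = 0<α ; 0<β = 0<β ; 0<γ = 0<γ ; 0<d = 0<d
  ; a²+b²≡γ² = pythagoras-ℤ⇒ℕ (∣ a ∣) (∣ b ∣) (∣ γ ∣) ab
  ; b²+c²≡α² = pythagoras-ℤ⇒ℕ (∣ b ∣) (∣ c ∣) (∣ α ∣) bc
  ; c²+a²≡β² = pythagoras-ℤ⇒ℕ (∣ c ∣) (∣ a ∣) (∣ β ∣) ca
  ; a²+b²+c²≡d² = ℤ.+-injective (begin
      + (∣ a ∣ ℕ.^ 2 ℕ.+ ∣ b ∣ ℕ.^ 2 ℕ.+ ∣ c ∣ ℕ.^ 2)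
        ≡⟨ ℤ.pos-+ (∣ a ∣ ℕ.^ 2 ℕ.+ ∣ b ∣ ℕ.^ 2) (∣ c ∣ ℕ.^ 2) ⟩
      + (∣ a ∣ ℕ.^ 2 ℕ.+ ∣ b ∣ ℕ.^ 2) + + (∣ c ∣ ℕ.^ 2)
        ≡⟨ cong₂ _+_ (sum-of-squares (∣ a ∣) (∣ b ∣)) (+[n^2] (∣ c ∣)) ⟩
      a ^ 2 + b ^ 2 + c ^ 2
        ≡⟨ abc ⟩
      d ^ 2
        ≡⟨ sym (+[n^2] (∣ d ∣)) ⟩
      + (∣ d ∣ ℕ.^ 2) ∎)
  }
-- An edge and the diagonal of the face orthogonal to it are the legs of a right triangle with
-- hypotenuse `d`, so this diagonal is `d` times the complementary sine or cosine. Its equation is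
-- `x² + y² + z² = d²` with the square of that edge cancelled.
cuboid-polynomial≡0⇒cuboid : ∀ {a b c u} →
  0ℤ < a → a < c → 0ℤ < b → b < c → 0ℤ < u → u < c →
  cuboid-polynomial a b c u ≡ 0ℤ → PerfectCuboid
cuboid-polynomial≡0⇒cuboid {a} {b} {c} {u} 0<a a<c 0<b b<c 0<u u<c P≡0 =
  integral-cuboid
    {x} {y} {z} {sin-numerator a c * (B * U)} {sin-numerator b c * (A * U)}
    {cos-numerator u c * (A * B)} {d}
    (*-pos-ℤ (0<cos 0<a a<c) (*-pos-ℤ 0<B 0<U))
    (*-pos-ℤ (0<cos 0<b b<c) (*-pos-ℤ 0<A 0<U))
    (*-pos-ℤ (0<sin 0<u) (*-pos-ℤ 0<A 0<B))
    (*-pos-ℤ (0<sin 0<a) (*-pos-ℤ 0<B 0<U))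
    (*-pos-ℤ (0<sin 0<b) (*-pos-ℤ 0<A 0<U))
    (*-pos-ℤ (0<cos 0<u u<c) (*-pos-ℤ 0<A 0<B))
    (*-pos-ℤ 0<A (*-pos-ℤ 0<B 0<U))
    (cancelʳ (z ^ 2) (begin
      x ^ 2 + y ^ 2 + z ^ 2
        ≡⟨ x²+y²+z²≡d² ⟩
      d ^ 2
        ≡⟨ cong (_^ 2) (cuboid-d-rotate₂ a b c u) ⟩
      (U * (A * B)) ^ 2
        ≡⟨ sym (cos²+sin² u c (A * B)) ⟩
      (cos-numerator u c * (A * B)) ^ 2 + z ^ 2 ∎))
    (cancelʳ (x ^ 2) (begin
      y ^ 2 + z ^ 2 + x ^ 2
        ≡⟨ solve 3 (λ X Y Z → Y :+ Z :+ X := X :+ Y :+ Z) refl (x ^ 2) (y ^ 2) (z ^ 2) ⟩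
      x ^ 2 + y ^ 2 + z ^ 2
        ≡⟨ x²+y²+z²≡d² ⟩
      d ^ 2
        ≡⟨ sym (cos²+sin² a c (B * U)) ⟩
      x ^ 2 + (sin-numerator a c * (B * U)) ^ 2
        ≡⟨ ℤ.+-comm (x ^ 2) _ ⟩
      (sin-numerator a c * (B * U)) ^ 2 + x ^ 2 ∎))
    (cancelʳ (y ^ 2) (begin
      z ^ 2 + x ^ 2 + y ^ 2
        ≡⟨ solve 3 (λ X Y Z → Z :+ X :+ Y := X :+ Y :+ Z) refl (x ^ 2) (y ^ 2) (z ^ 2) ⟩
      x ^ 2 + y ^ 2 + z ^ 2
        ≡⟨ x²+y²+z²≡d² ⟩
      d ^ 2
        ≡⟨ cong (_^ 2) (cuboid-d-rotate₁ a b c u) ⟩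
      (B * (A * U)) ^ 2
        ≡⟨ sym (cos²+sin² b c (A * U)) ⟩
      y ^ 2 + (sin-numerator b c * (A * U)) ^ 2
        ≡⟨ ℤ.+-comm (y ^ 2) _ ⟩
      (sin-numerator b c * (A * U)) ^ 2 + y ^ 2 ∎))
    x²+y²+z²≡d²
  where
  open ℤ-Solver.+-*-Solver
  A = denominator a c
  B = denominator b c
  U = denominator u c
  x = cuboid-x a b c u
  y = cuboid-y a b c u
  z = cuboid-z a b c u
  d = cuboid-d a b c u

  0<c : 0ℤ < c
  0<c = ℤ.<-trans 0<a a<c

  square-pos : ∀ {i} → 0ℤ < i → 0ℤ < i ^ 2
  square-pos {i} 0<i = subst (0ℤ <_) (cong (i *_) (sym (ℤ.*-identityʳ i))) (*-pos-ℤ 0<i 0<i)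

  0<den : ∀ {p} → 0ℤ < p → 0ℤ < denominator p c
  0<den 0<p = ℤ.+-mono-< (square-pos 0<c) (square-pos 0<p)

  0<sin : ∀ {p} → 0ℤ < p → 0ℤ < sin-numerator p c
  0<sin 0<p = *-pos-ℤ (*-pos-ℤ {+ 2} (+<+ (s≤s ℕ.z≤n)) 0<p) 0<c

  0<cos : ∀ {p} → 0ℤ < p → p < c → 0ℤ < cos-numerator p c
  0<cos {p} 0<p p<c = subst (0ℤ <_)
    (solve 2 (λ p c → (c :- p) :* (c :+ p) := c :^ 2 :- p :^ 2) refl p c)
    (*-pos-ℤ (i<j⇒0<j-i p<c) (ℤ.+-mono-< 0<c 0<p))

  0<A = 0<den 0<a
  0<B = 0<den 0<b
  0<U = 0<den 0<u

  cancelʳ : ∀ {i j} k → i + k ≡ j + k → i ≡ j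
  cancelʳ {i} {j} k i+k≡j+k = ∙-cancelʳ (AbelianGroup.group ℤ.+-0-abelianGroup) k i j i+k≡j+k

  cos²+sin² : ∀ p c k →
    (cos-numerator p c * k) ^ 2 + (sin-numerator p c * k) ^ 2 ≡ (denominator p c * k) ^ 2
  cos²+sin² = solve 3 (λ p c k →
    ((c :^ 2 :- p :^ 2) :* k) :^ 2 :+ (con (+ 2) :* p :* c :* k) :^ 2
    := ((c :^ 2 :+ p :^ 2) :* k) :^ 2) refl

  x²+y²+z²≡d² : x ^ 2 + y ^ 2 + z ^ 2 ≡ d ^ 2
  x²+y²+z²≡d² = ℤ.i-j≡0⇒i≡j _ _ (begin
    x ^ 2 + y ^ 2 + z ^ 2 - d ^ 2
      ≡⟨ solve 4 (λ x y z d → x :^ 2 :+ y :^ 2 :+ z :^ 2 :- d :^ 2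
           := x :* x :+ y :* y :+ z :* z :- d :* d) refl x y z d ⟩
    x * x + y * y + z * z - d * d
      ≡⟨ sym (cuboid-polynomial≡defect a b c u) ⟩
    cuboid-polynomial a b c u
      ≡⟨ P≡0 ⟩
    0ℤ ∎)

-- Integers and fractions inside the rationals

fromℚᵘ-homo-+ : ∀ p q → fromℚᵘ (p ℚᵘ.+ q) ≡ fromℚᵘ p ℚ.+ fromℚᵘ q
fromℚᵘ-homo-+ p q = ℚ.toℚᵘ-injective (
  ℚᵘ.≃-trans (ℚ.toℚᵘ-fromℚᵘ (p ℚᵘ.+ q)) (ℚᵘ.≃-sym (
  ℚᵘ.≃-trans (ℚ.toℚᵘ-homo-+ (fromℚᵘ p) (fromℚᵘ q))
  (ℚᵘ.+-cong (ℚ.toℚᵘ-fromℚᵘ p) (ℚ.toℚᵘ-fromℚᵘ q)))))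

fromℚᵘ-homo-* : ∀ p q → fromℚᵘ (p ℚᵘ.* q) ≡ fromℚᵘ p ℚ.* fromℚᵘ q
fromℚᵘ-homo-* p q = ℚ.toℚᵘ-injective (
  ℚᵘ.≃-trans (ℚ.toℚᵘ-fromℚᵘ (p ℚᵘ.* q)) (ℚᵘ.≃-sym (
  ℚᵘ.≃-trans (ℚ.toℚᵘ-homo-* (fromℚᵘ p) (fromℚᵘ q))
  (ℚᵘ.*-cong (ℚ.toℚᵘ-fromℚᵘ p) (ℚ.toℚᵘ-fromℚᵘ q)))))

fromℚᵘ-mono-< : ∀ {p q} → p ℚᵘ.< q → fromℚᵘ p ℚ.< fromℚᵘ q
fromℚᵘ-mono-< {p} {q} p<q = ℚ.toℚᵘ-cancel-<
  (ℚᵘ.<-respˡ-≃ (ℚᵘ.≃-sym (ℚ.toℚᵘ-fromℚᵘ p))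
  (ℚᵘ.<-respʳ-≃ (ℚᵘ.≃-sym (ℚ.toℚᵘ-fromℚᵘ q)) p<q))

fromℚᵘ-cancel-< : ∀ {p q} → fromℚᵘ p ℚ.< fromℚᵘ q → p ℚᵘ.< q
fromℚᵘ-cancel-< {p} {q} p<q =
  ℚᵘ.<-respˡ-≃ (ℚ.toℚᵘ-fromℚᵘ p) (ℚᵘ.<-respʳ-≃ (ℚ.toℚᵘ-fromℚᵘ q) (ℚ.toℚᵘ-mono-< p<q))

-- The `0` is the denominator less one. Starting from unnormalised fractions reduces equalities to
-- cross-multiplication.
fromℤ : ℤ → ℚ
fromℤ i = fromℚᵘ (mkℚᵘ i 0)

fromℤ-homo-+ : ∀ i j → fromℤ (i + j) ≡ fromℤ i ℚ.+ fromℤ j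
fromℤ-homo-+ i j = trans
  (ℚ.fromℚᵘ-cong {mkℚᵘ (i + j) 0} {mkℚᵘ i 0 ℚᵘ.+ mkℚᵘ j 0}
    (*≡* (cong (_* + 1) (sym (cong₂ _+_ (ℤ.*-identityʳ i) (ℤ.*-identityʳ j))))))
  (fromℚᵘ-homo-+ (mkℚᵘ i 0) (mkℚᵘ j 0))

fromℤ-homo-* : ∀ i j → fromℤ (i * j) ≡ fromℤ i ℚ.* fromℤ j
fromℤ-homo-* i j = fromℚᵘ-homo-* (mkℚᵘ i 0) (mkℚᵘ j 0)

fromℤ-homo-² : ∀ i → fromℤ (i ^ 2) ≡ fromℤ i ℚ.* fromℤ i
fromℤ-homo-² i = trans (cong (λ t → fromℤ (i * t)) (ℤ.*-identityʳ i)) (fromℤ-homo-* i i)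

fromℤ-pos : ∀ {i} → 0ℤ < i → 0ℚ ℚ.< fromℤ i
fromℤ-pos {i} 0<i = fromℚᵘ-mono-< {mkℚᵘ 0ℤ 0} {mkℚᵘ i 0}
  (*<* (subst (0ℤ <_) (sym (ℤ.*-identityʳ i)) 0<i))

-- Matching on `0<m` turns `m` into a successor, so that the fraction is `fromℚᵘ (mkℚᵘ p k)` by
-- computation.
fraction-* : ∀ {p m n l} (0<m : 0ℤ < m) → p * n ≡ l * m →
             p / m ⟨ 0<m ⟩ ℚ.* fromℤ n ≡ fromℤ l
fraction-* {p} {m} {n} {l} (+<+ (s≤s {n = k} _)) pn≡lm = trans
  (sym (fromℚᵘ-homo-* (mkℚᵘ p k) (mkℚᵘ n 0)))
  (ℚ.fromℚᵘ-cong {mkℚᵘ p k ℚᵘ.* mkℚᵘ n 0} {mkℚᵘ l 0} (*≡* (begin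
    p * n * + 1
      ≡⟨ ℤ.*-identityʳ (p * n) ⟩
    p * n
      ≡⟨ pn≡lm ⟩
    l * m
      ≡⟨ cong (l *_) (sym (ℤ.*-identityʳ m)) ⟩
    l * (m * + 1) ∎)))

0<fraction⇒0<numerator : ∀ p m (0<m : 0ℤ < m) → 0ℚ ℚ.< p / m ⟨ 0<m ⟩ → 0ℤ < p
0<fraction⇒0<numerator p m (+<+ (s≤s {n = k} _)) 0<p/m
  with *<* 0<p1 ← fromℚᵘ-cancel-< {mkℚᵘ 0ℤ 0} {mkℚᵘ p k} 0<p/m =
  subst (0ℤ <_) (ℤ.*-identityʳ p) 0<p1

fraction<1⇒numerator<denominator : ∀ p m (0<m : 0ℤ < m) → p / m ⟨ 0<m ⟩ ℚ.< 1ℚ → p < m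
fraction<1⇒numerator<denominator p m (+<+ (s≤s {n = k} _)) p/m<1
  with *<* p1<1m ← fromℚᵘ-cancel-< {mkℚᵘ p k} {mkℚᵘ (+ 1) 0} p/m<1 =
  subst₂ _<_ (ℤ.*-identityʳ p) (ℤ.*-identityˡ m) p1<1m

-- Half-angle formulas over the rationals

p<q⇒0<q-p : ∀ {p q} → p ℚ.< q → 0ℚ ℚ.< q ℚ.- p
p<q⇒0<q-p {p} {q} p<q = subst (ℚ._< q ℚ.- p) (ℚ.+-inverseʳ p) (ℚ.+-monoˡ-< (ℚ.- p) p<q)

0<q-p⇒p<q : ∀ {p q} → 0ℚ ℚ.< q ℚ.- p → p ℚ.< q
0<q-p⇒p<q {p} {q} 0<q-p = subst₂ ℚ._<_ (ℚ.+-identityˡ p)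
  (solve 2 (λ p q → q :- p :+ p := q) refl p q) (ℚ.+-monoˡ-< p 0<q-p)
  where open ℚ-Solver.+-*-Solver

*-cancelˡ-pos-ℚ : ∀ {p q r} → 0ℚ ℚ.< r → r ℚ.* p ≡ r ℚ.* q → p ≡ q
*-cancelˡ-pos-ℚ {p} {q} {r} 0<r rp≡rq = ℚ.≤-antisym
  (ℚ.*-cancelˡ-≤-pos r {{ℚ.positive 0<r}} (ℚ.≤-reflexive rp≡rq))
  (ℚ.*-cancelˡ-≤-pos r {{ℚ.positive 0<r}} (ℚ.≤-reflexive (sym rp≡rq)))

0<p*q⇒0<p : ∀ {p q} → 0ℚ ℚ.< q → 0ℚ ℚ.< p ℚ.* q → 0ℚ ℚ.< p
0<p*q⇒0<p {p} {q} 0<q 0<pq = ℚ.*-cancelʳ-<-nonNeg q {{ℚ.nonNegative (ℚ.<⇒≤ 0<q)}}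
  (subst (ℚ._< p ℚ.* q) (sym (ℚ.*-zeroˡ q)) 0<pq)

-- HalfAngle over ℚ, with the tangent q in place of p / m.
module HalfAngleℚ {q h l x : ℚ} (q[h+x]≡l : q ℚ.* (h ℚ.+ x) ≡ l)
                  (l²+x²≡h² : l ℚ.* l ℚ.+ x ℚ.* x ≡ h ℚ.* h)
                  (0<h : 0ℚ ℚ.< h) (0<x : 0ℚ ℚ.< x) (0<l : 0ℚ ℚ.< l) where
  open ℚ-Solver.+-*-Solver

  private
    0<h+x : 0ℚ ℚ.< h ℚ.+ x
    0<h+x = ℚ.+-mono-< 0<h 0<x

    q² = q ℚ.* q

  tangent-pos : 0ℚ ℚ.< q
  tangent-pos = 0<p*q⇒0<p 0<h+x (subst (0ℚ ℚ.<_) (sym q[h+x]≡l) 0<l)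

  -- Writing the factor `h` of `h q²` as `(h + x) - x` makes `q (h + x)` appear squared; it becomes
  -- `l²`, and `h² - (l² + x²)` drops out.
  half-angle-cosℚ : h ℚ.* (1ℚ ℚ.- q²) ≡ x ℚ.* (1ℚ ℚ.+ q²)
  half-angle-cosℚ = *-cancelˡ-pos-ℚ 0<h+x (begin
    (h ℚ.+ x) ℚ.* (h ℚ.* (1ℚ ℚ.- q²))
      ≡⟨ solve 3 (λ q h x →
           (h :+ x) :* (h :* (con 1ℚ :- q :* q))
           := h :* (h :+ x) :- (q :* (h :+ x)) :* (q :* (h :+ x)) :+ x :* q :* (q :* (h :+ x)))
           refl q h x ⟩
    h ℚ.* (h ℚ.+ x) ℚ.- (q ℚ.* (h ℚ.+ x)) ℚ.* (q ℚ.* (h ℚ.+ x)) ℚ.+ x ℚ.* q ℚ.* (q ℚ.* (h ℚ.+ x))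
      ≡⟨ cong (λ t → h ℚ.* (h ℚ.+ x) ℚ.- t ℚ.* t ℚ.+ x ℚ.* q ℚ.* (q ℚ.* (h ℚ.+ x))) q[h+x]≡l ⟩
    h ℚ.* (h ℚ.+ x) ℚ.- l ℚ.* l ℚ.+ x ℚ.* q ℚ.* (q ℚ.* (h ℚ.+ x))
      ≡⟨ solve 4 (λ q h l x →
           h :* (h :+ x) :- l :* l :+ x :* q :* (q :* (h :+ x))
           := h :* h :- (l :* l :+ x :* x) :+ (h :+ x) :* (x :* (con 1ℚ :+ q :* q)))
           refl q h l x ⟩
    h ℚ.* h ℚ.- (l ℚ.* l ℚ.+ x ℚ.* x) ℚ.+ (h ℚ.+ x) ℚ.* (x ℚ.* (1ℚ ℚ.+ q²))
      ≡⟨ cong (λ t → h ℚ.* h ℚ.- t ℚ.+ (h ℚ.+ x) ℚ.* (x ℚ.* (1ℚ ℚ.+ q²))) l²+x²≡h² ⟩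
    h ℚ.* h ℚ.- h ℚ.* h ℚ.+ (h ℚ.+ x) ℚ.* (x ℚ.* (1ℚ ℚ.+ q²))
      ≡⟨ solve 2 (λ s t → s :- s :+ t := t) refl (h ℚ.* h) _ ⟩
    (h ℚ.+ x) ℚ.* (x ℚ.* (1ℚ ℚ.+ q²)) ∎)

  half-angle-sinℚ : h ℚ.* (q ℚ.+ q) ≡ l ℚ.* (1ℚ ℚ.+ q²)
  half-angle-sinℚ = begin
    h ℚ.* (q ℚ.+ q)
      ≡⟨ solve 2 (λ q h →
           h :* (q :+ q)
           := q :* (h :* (con 1ℚ :+ q :* q)) :+ q :* (h :* (con 1ℚ :- q :* q))) refl q h ⟩
    q ℚ.* (h ℚ.* (1ℚ ℚ.+ q²)) ℚ.+ q ℚ.* (h ℚ.* (1ℚ ℚ.- q²))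
      ≡⟨ cong (λ t → q ℚ.* (h ℚ.* (1ℚ ℚ.+ q²)) ℚ.+ q ℚ.* t) half-angle-cosℚ ⟩
    q ℚ.* (h ℚ.* (1ℚ ℚ.+ q²)) ℚ.+ q ℚ.* (x ℚ.* (1ℚ ℚ.+ q²))
      ≡⟨ solve 4 (λ q h x e → q :* (h :* e) :+ q :* (x :* e) := q :* (h :+ x) :* e)
           refl q h x (1ℚ ℚ.+ q²) ⟩
    q ℚ.* (h ℚ.+ x) ℚ.* (1ℚ ℚ.+ q²)
      ≡⟨ cong (ℚ._* (1ℚ ℚ.+ q²)) q[h+x]≡l ⟩
    l ℚ.* (1ℚ ℚ.+ q²) ∎

  -- A positive cosine makes `1 - q²` positive, and the factor `1 + q` can be divided out.
  tangent<1 : q ℚ.< 1ℚ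
  tangent<1 = 0<q-p⇒p<q (0<p*q⇒0<p (ℚ.+-mono-< 0<1 tangent-pos) (subst (0ℚ ℚ.<_)
    (solve 1 (λ q → con 1ℚ :- q :* q := (con 1ℚ :- q) :* (con 1ℚ :+ q)) refl q) 0<1-q²))
    where
    0<1-q² : 0ℚ ℚ.< 1ℚ ℚ.- q²
    0<1-q² = 0<p*q⇒0<p 0<h (subst (0ℚ ℚ.<_)
      (trans (sym half-angle-cosℚ) (ℚ.*-comm h (1ℚ ℚ.- q²)))
      (*-pos 0<x (ℚ.+-mono-< 0<1 (*-pos tangent-pos tangent-pos))))

-- The equations defining `f` at rational points

-- Composition of the ratios x / d and γ / d: the cosines and sines of two
-- half-angle parameters multiply.
ratio-product : ∀ d γ x m p n r s t → 0ℚ ℚ.< d →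
  d ℚ.* m ≡ x ℚ.* p → d ℚ.* n ≡ γ ℚ.* r → γ ℚ.* s ≡ x ℚ.* t →
  m ℚ.* (r ℚ.* t) ≡ p ℚ.* (n ℚ.* s)
ratio-product d γ x m p n r s t 0<d dm≡xp dn≡γr γs≡xt = *-cancelˡ-pos-ℚ 0<d (begin
  d ℚ.* (m ℚ.* (r ℚ.* t))
    ≡⟨ solve 4 (λ d m r t → d :* (m :* (r :* t)) := d :* m :* (r :* t)) refl d m r t ⟩
  d ℚ.* m ℚ.* (r ℚ.* t)
    ≡⟨ cong (ℚ._* (r ℚ.* t)) dm≡xp ⟩
  x ℚ.* p ℚ.* (r ℚ.* t)
    ≡⟨ solve 4 (λ x p r t → x :* p :* (r :* t) := x :* t :* (p :* r)) refl x p r t ⟩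
  x ℚ.* t ℚ.* (p ℚ.* r)
    ≡⟨ cong (ℚ._* (p ℚ.* r)) (sym γs≡xt) ⟩
  γ ℚ.* s ℚ.* (p ℚ.* r)
    ≡⟨ solve 4 (λ γ s p r → γ :* s :* (p :* r) := γ :* r :* (p :* s)) refl γ s p r ⟩
  γ ℚ.* r ℚ.* (p ℚ.* s)
    ≡⟨ cong (ℚ._* (p ℚ.* s)) (sym dn≡γr) ⟩
  d ℚ.* n ℚ.* (p ℚ.* s)
    ≡⟨ solve 4 (λ d n p s → d :* n :* (p :* s) := d :* (p :* (n :* s))) refl d n p s ⟩
  d ℚ.* (p ℚ.* (n ℚ.* s)) ∎)
  where open ℚ-Solver.+-*-Solver

module _ where
  open ℚ-Solver.+-*-Solver

  -- The hypothesis is `cos A = cos U cos Z` in half-angle tangents with denominators cleared. Half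
  -- the difference of its sides is the difference of the sides of the conclusion.
  a²-equation : ∀ q u z →
    (1ℚ ℚ.- q ℚ.* q) ℚ.* ((1ℚ ℚ.+ u ℚ.* u) ℚ.* (1ℚ ℚ.+ z ℚ.* z))
      ≡ (1ℚ ℚ.+ q ℚ.* q) ℚ.* ((1ℚ ℚ.- u ℚ.* u) ℚ.* (1ℚ ℚ.- z ℚ.* z)) →
    q ℚ.* q ℚ.* (u ℚ.* u ℚ.* (z ℚ.* z) ℚ.+ 1ℚ) ≡ u ℚ.* u ℚ.+ z ℚ.* z
  a²-equation q u z eq = begin
    q ℚ.* q ℚ.* (u ℚ.* u ℚ.* (z ℚ.* z) ℚ.+ 1ℚ)
      ≡⟨ solve 3 (λ q u z →
           q :* q :* (u :* u :* (z :* z) :+ con 1ℚ)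
           := u :* u :+ z :* z :+ con ℚ.½ :*
             ((con 1ℚ :+ q :* q) :* ((con 1ℚ :- u :* u) :* (con 1ℚ :- z :* z))
              :- (con 1ℚ :- q :* q) :* ((con 1ℚ :+ u :* u) :* (con 1ℚ :+ z :* z))))
           refl q u z ⟩
    u ℚ.* u ℚ.+ z ℚ.* z ℚ.+ ℚ.½ ℚ.* (Y ℚ.- X)
      ≡⟨ cong (λ t → u ℚ.* u ℚ.+ z ℚ.* z ℚ.+ ℚ.½ ℚ.* (Y ℚ.- t)) eq ⟩
    u ℚ.* u ℚ.+ z ℚ.* z ℚ.+ ℚ.½ ℚ.* (Y ℚ.- Y)
      ≡⟨ solve 2 (λ s t → s :+ con ℚ.½ :* (t :- t) := s) refl (u ℚ.* u ℚ.+ z ℚ.* z) Y ⟩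
    u ℚ.* u ℚ.+ z ℚ.* z ∎
    where
    X = (1ℚ ℚ.- q ℚ.* q) ℚ.* ((1ℚ ℚ.+ u ℚ.* u) ℚ.* (1ℚ ℚ.+ z ℚ.* z))
    Y = (1ℚ ℚ.+ q ℚ.* q) ℚ.* ((1ℚ ℚ.- u ℚ.* u) ℚ.* (1ℚ ℚ.- z ℚ.* z))

  -- The same with `cos B = cos U sin Z`; here the two differences agree without the factor one
  -- half.
  b²-equation : ∀ q u z →
    (1ℚ ℚ.- q ℚ.* q) ℚ.* ((1ℚ ℚ.+ u ℚ.* u) ℚ.* (1ℚ ℚ.+ z ℚ.* z))
      ≡ (1ℚ ℚ.+ q ℚ.* q) ℚ.* ((1ℚ ℚ.- u ℚ.* u) ℚ.* (z ℚ.+ z)) →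
    q ℚ.* q ℚ.* ((1ℚ ℚ.+ u ℚ.* u) ℚ.* (1ℚ ℚ.+ z ℚ.* z)
                 ℚ.+ (1ℚ ℚ.+ 1ℚ) ℚ.* z ℚ.* (1ℚ ℚ.- u ℚ.* u))
      ≡ (1ℚ ℚ.+ u ℚ.* u) ℚ.* (1ℚ ℚ.+ z ℚ.* z) ℚ.- (1ℚ ℚ.+ 1ℚ) ℚ.* z ℚ.* (1ℚ ℚ.- u ℚ.* u)
  b²-equation q u z eq = begin
    q ℚ.* q ℚ.* (E ℚ.+ F)
      ≡⟨ solve 3 (λ q u z →
           let E = (con 1ℚ :+ u :* u) :* (con 1ℚ :+ z :* z)
               F = con (1ℚ ℚ.+ 1ℚ) :* z :* (con 1ℚ :- u :* u)
           in q :* q :* (E :+ F)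
              := E :- F :+ ((con 1ℚ :+ q :* q) :* ((con 1ℚ :- u :* u) :* (z :+ z))
                            :- (con 1ℚ :- q :* q) :* E)) refl q u z ⟩
    E ℚ.- F ℚ.+ (Y ℚ.- (1ℚ ℚ.- q ℚ.* q) ℚ.* E)
      ≡⟨ cong (λ t → E ℚ.- F ℚ.+ (Y ℚ.- t)) eq ⟩
    E ℚ.- F ℚ.+ (Y ℚ.- Y)
      ≡⟨ solve 2 (λ s t → s :+ (t :- t) := s) refl (E ℚ.- F) Y ⟩
    E ℚ.- F ∎
    where
    E = (1ℚ ℚ.+ u ℚ.* u) ℚ.* (1ℚ ℚ.+ z ℚ.* z)
    F = (1ℚ ℚ.+ 1ℚ) ℚ.* z ℚ.* (1ℚ ℚ.- u ℚ.* u)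
    Y = (1ℚ ℚ.+ q ℚ.* q) ℚ.* ((1ℚ ℚ.- u ℚ.* u) ℚ.* (z ℚ.+ z))

fromℤ-pythagoras : ∀ {l x h} → l ^ 2 + x ^ 2 ≡ h ^ 2 →
  fromℤ l ℚ.* fromℤ l ℚ.+ fromℤ x ℚ.* fromℤ x ≡ fromℤ h ℚ.* fromℤ h
fromℤ-pythagoras {l} {x} {h} l²+x²≡h² = begin
  fromℤ l ℚ.* fromℤ l ℚ.+ fromℤ x ℚ.* fromℤ x
    ≡⟨ sym (cong₂ ℚ._+_ (fromℤ-homo-² l) (fromℤ-homo-² x)) ⟩
  fromℤ (l ^ 2) ℚ.+ fromℤ (x ^ 2)
    ≡⟨ sym (fromℤ-homo-+ (l ^ 2) (x ^ 2)) ⟩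
  fromℤ (l ^ 2 + x ^ 2)
    ≡⟨ cong fromℤ l²+x²≡h² ⟩
  fromℤ (h ^ 2)
    ≡⟨ fromℤ-homo-² h ⟩
  fromℤ h ℚ.* fromℤ h ∎

module HalfAngleFraction {p m h l x : ℤ} (0<m : 0ℤ < m) (0<h : 0ℤ < h) (0<x : 0ℤ < x)
                         (0<l : 0ℤ < l) (p[h+x]≡lm : p * (h + x) ≡ l * m)
                         (l²+x²≡h² : l ^ 2 + x ^ 2 ≡ h ^ 2) =
  HalfAngleℚ {p / m ⟨ 0<m ⟩}
    (trans (cong (p / m ⟨ 0<m ⟩ ℚ.*_) (sym (fromℤ-homo-+ h x)))
           (fraction-* {p} {m} {h + x} {l} 0<m p[h+x]≡lm))
    (fromℤ-pythagoras {l} {x} {h} l²+x²≡h²) (fromℤ-pos 0<h) (fromℤ-pos 0<x) (fromℤ-pos 0<l)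

-- Rational constants among the reals, and bounds on `D-ab`

0<fromℚ⇒0< : ∀ {q} → 0ʳ <ʳ fromℚ q → 0ℚ ℚ.< q
0<fromℚ⇒0< {q} (ε , 0<ε , N , ε≤q-0) =
  ℚ.<-≤-trans 0<ε (subst (ε ℚ.≤_) (ℚ.+-identityʳ q) (ε≤q-0 N ℕ.≤-refl))

fromℚ-mono-< : ∀ {p q} → p ℚ.< q → fromℚ p <ʳ fromℚ q
fromℚ-mono-< {p} {q} p<q = q ℚ.- p , p<q⇒0<q-p p<q , 0 , λ _ _ → ℚ.≤-refl

-- Lets the difference be replaced by an expression `w` that is visibly positive, such as a product
-- of positive factors.
positive-difference⇒<ʳ : ∀ {x y w} → (∀ n → seq w n ≡ seq y n ℚ.- seq x n) → 0ʳ <ʳ w → x <ʳ y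
positive-difference⇒<ʳ {w = w} w≡y-x (ε , 0<ε , N , ε≤w-0) = ε , 0<ε , N , λ n N≤n →
  subst (ε ℚ.≤_) (trans (ℚ.+-identityʳ (seq w n)) (w≡y-x n)) (ε≤w-0 n N≤n)

eventually-pos : ∀ {x} → 0ʳ <ʳ x → ∃[ K ] (∀ n → K ℕ.≤ n → 0ℚ ℚ.< seq x n)
eventually-pos {x} (ε , 0<ε , K , ε≤x-0) = K , λ n K≤n →
  ℚ.<-≤-trans 0<ε (subst (ε ℚ.≤_) (ℚ.+-identityʳ (seq x n)) (ε≤x-0 n K≤n))

-- Once the terms of `y` are positive the two sequences agree exactly, so one index serves every
-- `ε`.
fromℚ≈÷ : ∀ {q x y} (0<y : 0ʳ <ʳ y) → (∀ n → q ℚ.* seq y n ≡ seq x n) →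
          fromℚ q ≈ʳ x ÷ʳ y ⟨ 0<y ⟩
fromℚ≈÷ {q} {x} {y} 0<y qy≡x ε 0<ε with K , pos ← eventually-pos {y} 0<y =
  K , λ n K≤n → subst (λ t → ℚ.∣ t ∣ ℚ.< ε) (sym (difference n (pos n K≤n))) 0<ε
  where
  open ℚ-Solver.+-*-Solver

  difference : ∀ n → 0ℚ ℚ.< seq y n → q ℚ.- seq x n ℚ.* recip (seq y n) ≡ 0ℚ
  difference n 0<yₙ = begin
    q ℚ.- seq x n ℚ.* recip (seq y n)
      ≡⟨ cong (λ t → q ℚ.- t ℚ.* recip (seq y n)) (sym (qy≡x n)) ⟩
    q ℚ.- q ℚ.* seq y n ℚ.* recip (seq y n)
      ≡⟨ solve 3 (λ q y r → q :- q :* y :* r := q :* (con 1ℚ :- r :* y)) refl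
           q (seq y n) (recip (seq y n)) ⟩
    q ℚ.* (1ℚ ℚ.- recip (seq y n) ℚ.* seq y n)
      ≡⟨ cong (λ t → q ℚ.* (1ℚ ℚ.- t)) (recip-inverseˡ (seq y n) 0<yₙ) ⟩
    q ℚ.* 0ℚ
      ≡⟨ ℚ.*-zeroʳ q ⟩
    0ℚ ∎

p≤∣p∣ : ∀ p → p ℚ.≤ ℚ.∣ p ∣
p≤∣p∣ p with ℚ.≤-total 0ℚ p
... | inj₁ 0≤p = ℚ.≤-reflexive (sym (ℚ.0≤p⇒∣p∣≡p 0≤p))
... | inj₂ p≤0 = ℚ.≤-trans p≤0 (ℚ.0≤∣p∣ p)

-- With `r = 1 / C`, this is `q - x / y ≥ (y - x) / y ≥ δ / C`, a gap that does not depend on the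
-- individual terms.
quotient-gap : ∀ {q x y δ r C} → 0ℚ ℚ.< δ → 0ℚ ℚ.< r → 0ℚ ℚ.< y → 1ℚ ℚ.≤ q →
  δ ℚ.≤ y ℚ.- x → y ℚ.≤ C → C ℚ.* r ≡ 1ℚ → δ ℚ.* r ℚ.≤ q ℚ.- x ℚ.* recip y
quotient-gap {q} {x} {y} {δ} {r} {C} 0<δ 0<r 0<y 1≤q δ≤y-x y≤C Cr≡1 =
  ℚ.*-cancelʳ-≤-pos y {{ℚ.positive 0<y}} (R.begin
    δ ℚ.* r ℚ.* y
      R.≤⟨ ℚ.*-monoˡ-≤-nonNeg (δ ℚ.* r) {{ℚ.nonNegative (ℚ.<⇒≤ (*-pos 0<δ 0<r))}} y≤C ⟩
    δ ℚ.* r ℚ.* C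
      R.≡⟨ solve 3 (λ δ r C → δ :* r :* C := δ :* (C :* r)) refl δ r C ⟩
    δ ℚ.* (C ℚ.* r)
      R.≡⟨ trans (cong (δ ℚ.*_) Cr≡1) (ℚ.*-identityʳ δ) ⟩
    δ
      R.≤⟨ δ≤y-x ⟩
    y ℚ.- x
      R.≡⟨ cong (ℚ._- x) (sym (ℚ.*-identityˡ y)) ⟩
    1ℚ ℚ.* y ℚ.- x
      R.≤⟨ ℚ.+-monoˡ-≤ (ℚ.- x)
             (ℚ.*-monoʳ-≤-nonNeg y {{ℚ.nonNegative (ℚ.<⇒≤ 0<y)}} 1≤q) ⟩
    q ℚ.* y ℚ.- x
      R.≡⟨ cong (λ t → q ℚ.* y ℚ.- t)
             (sym (trans (cong (x ℚ.*_) (recip-inverseˡ y 0<y)) (ℚ.*-identityʳ x))) ⟩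
    q ℚ.* y ℚ.- x ℚ.* (recip y ℚ.* y)
      R.≡⟨ solve 4 (λ q x y s → q :* y :- x :* (s :* y) := (q :- x :* s) :* y) refl
             q x y (recip y) ⟩
    (q ℚ.- x ℚ.* recip y) ℚ.* y R.∎)
  where
  open ℚ-Solver.+-*-Solver
  module R = ℚ.≤-Reasoning

-- If `1 ≤ q`, the quotients would stay at least `δ * r` below `q`, while convergence brings them
-- closer than that. The index `n` is late enough for all four eventual bounds.
≈÷⇒<1 : ∀ {q x y} (0<y : 0ʳ <ʳ y) → x <ʳ y → fromℚ q ≈ʳ x ÷ʳ y ⟨ 0<y ⟩ → q ℚ.< 1ℚ
≈÷⇒<1 {q} {x} {y} 0<y (δ , 0<δ , K₁ , δ≤y-x) q≈x÷y = ℚ.≰⇒> λ 1≤q →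
  let K₀ , pos            = eventually-pos {y} 0<y
      C , 0<C , K₂ , ∣y∣≤C = bounded y
      r , 0<r , Cr≡1      = inverse-pos 0<C
      K₃ , close          = q≈x÷y (δ ℚ.* r) (*-pos 0<δ 0<r)
      K                   = K₀ ℕ.⊔ K₁
      L                   = K₂ ℕ.⊔ K₃
      n                   = K ℕ.⊔ L
      K≤n                 = ℕ.m≤m⊔n K L
      L≤n                 = ℕ.m≤n⊔m K L
  in ℚ.<-irrefl refl (ℚ.≤-<-trans
       (quotient-gap 0<δ 0<r (pos n (ℕ.m⊔n≤o⇒m≤o K₀ K₁ K≤n)) 1≤q
         (δ≤y-x n (ℕ.m⊔n≤o⇒n≤o K₀ K₁ K≤n))
         (ℚ.≤-trans (p≤∣p∣ (seq y n)) (∣y∣≤C n (ℕ.m⊔n≤o⇒m≤o K₂ K₃ L≤n))) Cr≡1)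
       (ℚ.≤-<-trans (p≤∣p∣ (q ℚ.- seq x n ℚ.* recip (seq y n)))
         (close n (ℕ.m⊔n≤o⇒n≤o K₂ K₃ L≤n))))

q²<1⇒q<1 : ∀ {q} → q ℚ.* q ℚ.< 1ℚ → q ℚ.< 1ℚ
q²<1⇒q<1 {q} q²<1 = ℚ.≰⇒> λ 1≤q → ℚ.<-irrefl refl
  (ℚ.≤-<-trans (*-mono-≤-nonNeg (ℚ.<⇒≤ 0<1) (ℚ.≤-trans (ℚ.<⇒≤ 0<1) 1≤q) 1≤q 1≤q) q²<1)

module _ (p q : ℚ) (pq∈D : D-ab (fromℚ p) (fromℚ q)) where
  open ℚ-Solver.+-*-Solver
  private
    u = proj₁ pq∈D
    z = proj₁ (proj₂ pq∈D)
    uz∈D = proj₁ (proj₂ (proj₂ pq∈D))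
    fuz≡pq = proj₂ (proj₂ (proj₂ pq∈D))

  open D-uz uz∈D
  open f-value fuz≡pq

  D-ab⇒0<a : 0ℚ ℚ.< p
  D-ab⇒0<a = 0<fromℚ⇒0< 0<a

  D-ab⇒0<b : 0ℚ ℚ.< q
  D-ab⇒0<b = 0<fromℚ⇒0< 0<b

  -- In the quotient for `a²`, denominator minus numerator is `(1 - u²)(1 - z²)`.
  D-ab⇒a<1 : p ℚ.< 1ℚ
  D-ab⇒a<1 = q²<1⇒q<1 (≈÷⇒<1 {x = u ² +ʳ z ²} {y = u ² *ʳ z ² +ʳ 1ʳ} (a²-denominator-pos uz∈D)
    (positive-difference⇒<ʳ {x = u ² +ʳ z ²} {y = u ² *ʳ z ² +ʳ 1ʳ}
       {w = (1ʳ -ʳ u ²) *ʳ (1ʳ -ʳ z ²)}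
      (λ n → solve 2 (λ u z →
        (con 1ℚ :- u :* u) :* (con 1ℚ :- z :* z)
        := u :* u :* (z :* z) :+ con 1ℚ :- (u :* u :+ z :* z)) refl (seq u n) (seq z n))
      (*ʳ-pos {1ʳ -ʳ u ²} {1ʳ -ʳ z ²} (0<1-x² {u} 0<u u<1) (0<1-x² {z} 0<z z<1)))
    a²≈)

  -- In the quotient for `b²`, denominator minus numerator is `F + F`, that is `4 z (1 - u²)`.
  D-ab⇒b<1 : q ℚ.< 1ℚ
  D-ab⇒b<1 = q²<1⇒q<1 (≈÷⇒<1 {x = E -ʳ F} {y = E +ʳ F} (b²-denominator-pos uz∈D)
    (positive-difference⇒<ʳ {x = E -ʳ F} {y = E +ʳ F} {w = F +ʳ F}
      (λ n → solve 2 (λ e f → f :+ f := e :+ f :- (e :- f)) refl (seq E n) (seq F n))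
      (+ʳ-pos {F} {F} 0<F 0<F))
    b²≈)
    where
    E = (1ʳ +ʳ u ²) *ʳ (1ʳ +ʳ z ²)
    F = 2ʳ *ʳ z *ʳ (1ʳ -ʳ u ²)

    0<F : 0ʳ <ʳ F
    0<F = *ʳ-pos {2ʳ *ʳ z} {1ʳ -ʳ u ²} (*ʳ-pos {2ʳ} {z} 0<2ʳ 0<z) (0<1-x² {u} 0<u u<1)

-- The solution attached to a cuboid

-- The half-angle tangents of the cuboid scaled to d = 1, written over the
-- common denominator (d + γ)(d + a)(d + b).
module Parametrisation (cuboid : PerfectCuboid) where
  open ℤ-Solver.+-*-Solver
  private module P = PerfectCuboid cuboid

  a b c α β γ d : ℤ
  a = + P.a
  b = + P.b
  c = + P.c
  α = + P.α
  β = + P.β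
  γ = + P.γ
  d = + P.d

  a²+b²+c²≡d² : a ^ 2 + b ^ 2 + c ^ 2 ≡ d ^ 2
  a²+b²+c²≡d² = begin
    a ^ 2 + b ^ 2 + c ^ 2
      ≡⟨ sym (cong₂ _+_ (sum-of-squares P.a P.b) (+[n^2] P.c)) ⟩
    + (P.a ℕ.^ 2 ℕ.+ P.b ℕ.^ 2) + + (P.c ℕ.^ 2)
      ≡⟨ sym (ℤ.pos-+ (P.a ℕ.^ 2 ℕ.+ P.b ℕ.^ 2) (P.c ℕ.^ 2)) ⟩
    + (P.a ℕ.^ 2 ℕ.+ P.b ℕ.^ 2 ℕ.+ P.c ℕ.^ 2)
      ≡⟨ cong +_ P.a²+b²+c²≡d² ⟩
    + (P.d ℕ.^ 2)
      ≡⟨ +[n^2] P.d ⟩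
    d ^ 2 ∎

  a²+b²≡γ² : a ^ 2 + b ^ 2 ≡ γ ^ 2
  a²+b²≡γ² = pythagoras-ℕ⇒ℤ P.a P.b P.γ P.a²+b²≡γ²

  b²+a²≡γ² : b ^ 2 + a ^ 2 ≡ γ ^ 2
  b²+a²≡γ² = trans (ℤ.+-comm (b ^ 2) (a ^ 2)) a²+b²≡γ²

  α²+a²≡d² : α ^ 2 + a ^ 2 ≡ d ^ 2
  α²+a²≡d² = begin
    α ^ 2 + a ^ 2
      ≡⟨ cong (λ t → t + a ^ 2) (sym (pythagoras-ℕ⇒ℤ P.b P.c P.α P.b²+c²≡α²)) ⟩
    b ^ 2 + c ^ 2 + a ^ 2
      ≡⟨ solve 3 (λ A B C → B :+ C :+ A := A :+ B :+ C) refl (a ^ 2) (b ^ 2) (c ^ 2) ⟩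
    a ^ 2 + b ^ 2 + c ^ 2
      ≡⟨ a²+b²+c²≡d² ⟩
    d ^ 2 ∎

  β²+b²≡d² : β ^ 2 + b ^ 2 ≡ d ^ 2
  β²+b²≡d² = begin
    β ^ 2 + b ^ 2
      ≡⟨ cong (λ t → t + b ^ 2) (sym (pythagoras-ℕ⇒ℤ P.c P.a P.β P.c²+a²≡β²)) ⟩
    c ^ 2 + a ^ 2 + b ^ 2
      ≡⟨ solve 3 (λ A B C → C :+ A :+ B := A :+ B :+ C) refl (a ^ 2) (b ^ 2) (c ^ 2) ⟩
    a ^ 2 + b ^ 2 + c ^ 2
      ≡⟨ a²+b²+c²≡d² ⟩
    d ^ 2 ∎

  c²+γ²≡d² : c ^ 2 + γ ^ 2 ≡ d ^ 2
  c²+γ²≡d² = begin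
    c ^ 2 + γ ^ 2
      ≡⟨ cong (λ t → c ^ 2 + t) (sym a²+b²≡γ²) ⟩
    c ^ 2 + (a ^ 2 + b ^ 2)
      ≡⟨ ℤ.+-comm (c ^ 2) (a ^ 2 + b ^ 2) ⟩
    a ^ 2 + b ^ 2 + c ^ 2
      ≡⟨ a²+b²+c²≡d² ⟩
    d ^ 2 ∎

  0<a : 0ℤ < a
  0<a = +<+ P.0<a

  0<b : 0ℤ < b
  0<b = +<+ P.0<b

  0<c : 0ℤ < c
  0<c = +<+ P.0<c

  0<α : 0ℤ < α
  0<α = +<+ P.0<α

  0<β : 0ℤ < β
  0<β = +<+ P.0<β

  0<γ : 0ℤ < γ
  0<γ = +<+ P.0<γ

  0<d : 0ℤ < d
  0<d = +<+ P.0<d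

  -- Divided by `c′`, the numerators are `α / (d + a)`, `β / (d + b)` and `c / (d + γ)`, each of the
  -- form `sin t / (1 + cos t)`.
  a′ b′ c′ u′ : ℤ
  a′ = α * ((d + γ) * (d + b))
  b′ = β * ((d + γ) * (d + a))
  u′ = c * ((d + a) * (d + b))
  c′ = (d + γ) * (d + a) * (d + b)

  0<c′ : 0ℤ < c′
  0<c′ = *-pos-ℤ (*-pos-ℤ (ℤ.+-mono-< 0<d 0<γ) (ℤ.+-mono-< 0<d 0<a)) (ℤ.+-mono-< 0<d 0<b)

  a′-tangent : a′ * (d + a) ≡ α * c′
  a′-tangent = solve 4 (λ α g k l → α :* (g :* l) :* k := α :* (g :* k :* l)) refl
    α (d + γ) (d + a) (d + b)

  b′-tangent : b′ * (d + b) ≡ β * c′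
  b′-tangent = solve 4 (λ β g k l → β :* (g :* k) :* l := β :* (g :* k :* l)) refl
    β (d + γ) (d + a) (d + b)

  u′-tangent : u′ * (d + γ) ≡ c * c′
  u′-tangent = solve 4 (λ c g k l → c :* (k :* l) :* g := c :* (g :* k :* l)) refl
    c (d + γ) (d + a) (d + b)

  cuboid⇒polynomial≡0 : cuboid-polynomial a′ b′ c′ u′ ≡ 0ℤ
  cuboid⇒polynomial≡0 = similar⇒cuboid-polynomial≡0 {a′} {b′} {c′} {u′} {a} {b} {c} {d}
    0<d a²+b²+c²≡d²
    (half-angle-cos {a′} {c′} {d} {α} {a} a′-tangent α²+a²≡d² (ℤ.+-mono-< 0<d 0<a))
    (half-angle-cos {b′} {c′} {d} {β} {b} b′-tangent β²+b²≡d² (ℤ.+-mono-< 0<d 0<b))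
    -- The third angle has cosine `γ / d`, so the edge `c` enters through its sine.
    (half-angle-sin {u′} {c′} {d} {c} {γ} u′-tangent c²+γ²≡d² 0<c′ (ℤ.+-mono-< 0<d 0<γ))

  -- `A`, `B` and `U` belong to right triangles with hypotenuse `d`; `Z` belongs to the triangle in
  -- the face with edges `a`, `b` and hypotenuse `γ`.
  module A = HalfAngleFraction {a′} {c′} {d} {α} {a} 0<c′ 0<d 0<a 0<α a′-tangent α²+a²≡d²
  module B = HalfAngleFraction {b′} {c′} {d} {β} {b} 0<c′ 0<d 0<b 0<β b′-tangent β²+b²≡d²
  module U = HalfAngleFraction {u′} {c′} {d} {c} {γ} 0<c′ 0<d 0<γ 0<c u′-tangent c²+γ²≡d²
  module Z = HalfAngleFraction {b} {γ + a} {γ} {b} {a}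
    (ℤ.+-mono-< 0<γ 0<a) 0<γ 0<a 0<b refl b²+a²≡γ²

  p q v z : ℚ
  p = a′ / c′ ⟨ 0<c′ ⟩
  q = b′ / c′ ⟨ 0<c′ ⟩
  v = u′ / c′ ⟨ 0<c′ ⟩
  z = b / (γ + a) ⟨ ℤ.+-mono-< 0<γ 0<a ⟩

  vz∈D : D-uz (fromℚ v) (fromℚ z)
  vz∈D = record
    { 0<u = fromℚ-mono-< U.tangent-pos
    ; u<1 = fromℚ-mono-< U.tangent<1
    ; 0<z = fromℚ-mono-< Z.tangent-pos
    ; z<1 = fromℚ-mono-< Z.tangent<1
    }

  pq∈D-ab : D-ab (fromℚ p) (fromℚ q)
  pq∈D-ab = fromℚ v , fromℚ z , vz∈D , record
    { 0<a = fromℚ-mono-< A.tangent-pos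
    ; 0<b = fromℚ-mono-< B.tangent-pos
    ; a²≈ = fromℚ≈÷ {q = p ℚ.* p} {x = V ² +ʳ Z ²} {y = V ² *ʳ Z ² +ʳ 1ʳ}
            (a²-denominator-pos vz∈D) λ _ →
        -- `a / d = (γ / d)(a / γ)`, that is `cos A = cos U cos Z`.
        a²-equation p v z (ratio-product (fromℤ d) (fromℤ γ) (fromℤ a)
          (1ℚ ℚ.- p ℚ.* p) (1ℚ ℚ.+ p ℚ.* p) (1ℚ ℚ.- v ℚ.* v) (1ℚ ℚ.+ v ℚ.* v)
          (1ℚ ℚ.- z ℚ.* z) (1ℚ ℚ.+ z ℚ.* z) (fromℤ-pos 0<d)
          A.half-angle-cosℚ U.half-angle-cosℚ Z.half-angle-cosℚ)
    ; b²≈ = fromℚ≈÷ {q = q ℚ.* q} {x = E -ʳ F} {y = E +ʳ F}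
            (b²-denominator-pos vz∈D) λ _ →
        -- `b / d = (γ / d)(b / γ)`, that is `cos B = cos U sin Z`.
        b²-equation q v z (ratio-product (fromℤ d) (fromℤ γ) (fromℤ b)
          (1ℚ ℚ.- q ℚ.* q) (1ℚ ℚ.+ q ℚ.* q) (1ℚ ℚ.- v ℚ.* v) (1ℚ ℚ.+ v ℚ.* v)
          (z ℚ.+ z) (1ℚ ℚ.+ z ℚ.* z) (fromℤ-pos 0<d)
          B.half-angle-cosℚ U.half-angle-cosℚ Z.half-angle-sinℚ)
    }
    where
    V = fromℚ v
    Z = fromℚ z
    E = (1ʳ +ʳ V ²) *ʳ (1ʳ +ʳ Z ²)
    F = 2ʳ *ʳ Z *ʳ (1ʳ -ʳ V ²)

theorem5p3 :
  PerfectCuboid ⇔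
  (∃[ a ] ∃[ b ] ∃[ c ] ∃[ u ] Σ[ 0<c ∈ 0ℤ < c ]
    (0ℚ ℚ.< u / c ⟨ 0<c ⟩ × u / c ⟨ 0<c ⟩ ℚ.< 1ℚ)
    × D-ab (fromℚ (a / c ⟨ 0<c ⟩)) (fromℚ (b / c ⟨ 0<c ⟩))
    × u ^ 4 * a ^ 4 * b ^ 4 + + 6 * a ^ 4 * u ^ 2 * b ^ 4 * c ^ 2
        - + 2 * u ^ 4 * a ^ 4 * b ^ 2 * c ^ 2 - + 2 * u ^ 4 * a ^ 2 * b ^ 4 * c ^ 2
        + + 4 * u ^ 2 * b ^ 4 * a ^ 2 * c ^ 4 + + 4 * a ^ 4 * u ^ 2 * b ^ 2 * c ^ 4
        - + 12 * u ^ 4 * a ^ 2 * b ^ 2 * c ^ 4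
        + u ^ 4 * a ^ 4 * c ^ 4 + u ^ 4 * b ^ 4 * c ^ 4 + a ^ 4 * b ^ 4 * c ^ 4
        + + 6 * a ^ 4 * u ^ 2 * c ^ 6 + + 6 * u ^ 2 * b ^ 4 * c ^ 6
        - + 8 * a ^ 2 * b ^ 2 * u ^ 2 * c ^ 6
        - + 2 * u ^ 4 * a ^ 2 * c ^ 6 - + 2 * u ^ 4 * b ^ 2 * c ^ 6
        - + 2 * a ^ 4 * b ^ 2 * c ^ 6 - + 2 * b ^ 4 * a ^ 2 * c ^ 6
        + u ^ 4 * c ^ 8 + b ^ 4 * c ^ 8 + a ^ 4 * c ^ 8
        + + 4 * a ^ 2 * u ^ 2 * c ^ 8 + + 4 * b ^ 2 * u ^ 2 * c ^ 8
        - + 12 * b ^ 2 * a ^ 2 * c ^ 8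
        + + 6 * u ^ 2 * c ^ 10 - + 2 * a ^ 2 * c ^ 10 - + 2 * b ^ 2 * c ^ 10
        + c ^ 12
      ≡ 0ℤ)
theorem5p3 = mk⇔
  (λ cuboid → let open Parametrisation cuboid in
    a′ , b′ , c′ , u′ , 0<c′ , (U.tangent-pos , U.tangent<1) , pq∈D-ab , cuboid⇒polynomial≡0)
  (λ { (a , b , c , u , 0<c , (0<u/c , u/c<1) , ab∈D , P≡0) →
    let p = a / c ⟨ 0<c ⟩
        q = b / c ⟨ 0<c ⟩
    in cuboid-polynomial≡0⇒cuboid {a} {b} {c} {u}
      (0<fraction⇒0<numerator a c 0<c (D-ab⇒0<a p q ab∈D))
      (fraction<1⇒numerator<denominator a c 0<c (D-ab⇒a<1 p q ab∈D))
      (0<fraction⇒0<numerator b c 0<c (D-ab⇒0<b p q ab∈D))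
      (fraction<1⇒numerator<denominator b c 0<c (D-ab⇒b<1 p q ab∈D))
      (0<fraction⇒0<numerator u c 0<c 0<u/c)
      (fraction<1⇒numerator<denominator u c 0<c u/c<1)
      -- `cuboid-polynomial a b c u` unfolds to the expression in the statement, so the equation
      -- passes unchanged.
      P≡0 })
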